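{- Let $\mathcal{C}$ be any good coloring of any triangulation of the $2$-sphere in which all vertices have degree $6$ except exactly three vertices, which have degree $2$. Let $f$ be the fold count of $\mathcal{C}$ and $F$ the number of faces of the triangulation. Then $f^2/F\geq 3$.
   Context: A good coloring of a triangulation is a coloring of its faces black and white such that around each vertex the number of black faces is congruent mod $3$ to the number of white faces. The fold count of a good coloring is the number of edges whose two incident faces have different colors. -}

module Defs where

open import Data.Nat using (ℕ; zero; suc; _+_; _*_; _≤_)
open import Data.Nat.DivMod using (_%_; _/_)
open import Data.Fin using (Fin; zero; suc)
open import Data.Fin.Properties using () renaming (_≟_ to _≟F_)
open import Data.Bool using (Bool; true; false; not)
open import Data.Bool.Properties using () renaming (_≟_ to _≟B_)
open import Data.Product using (_×_; _,_; proj₁; proj₂; ∃)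
open import Relation.Nullary using (¬_; Dec; yes; no)
open import Relation.Binary.PropositionalEquality using (_≡_)

sumFin : (n : ℕ) → (Fin n → ℕ) → ℕ
sumFin zero    f = 0
sumFin (suc n) f = f zero + sumFin n (λ i → f (suc i))

countFin : (n : ℕ) → {P : Fin n → Set} → ((i : Fin n) → Dec (P i)) → ℕ
countFin n P? = sumFin n (λ i → ind (P? i))
  where
  ind : ∀ {A : Set} → Dec A → ℕ
  ind (yes _) = 1
  ind (no  _) = 0

next3 : Fin 3 → Fin 3
next3 zero             = suc zero
next3 (suc zero)       = suc (suc zero)
next3 (suc (suc zero)) = zero

iter : {A : Set} → ℕ → (A → A) → A → A
iter zero    g x = x
iter (suc k) g x = g (iter k g x)

-- Darts (= sides of triangles) and corners of a collection of F triangles: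
-- (t , i) is side i of triangle t, going (counterclockwise) from corner i to
-- corner (i+1 mod 3); the same pair also names corner i of triangle t.
Dart : ℕ → Set
Dart F = Fin F × Fin 3

data Reach {F : ℕ} (glue : Dart F → Dart F) (c : Dart F) : Dart F → Set where
  here  : Reach glue c c
  step-glue : ∀ {d} → Reach glue c d → Reach glue c (glue d)
  step-next : ∀ {t i} → Reach glue c (t , i) → Reach glue c (t , next3 i)

-- A (generalised, possibly non-simplicial) triangulation of the 2-sphere,
-- given as an oriented gluing of F triangles along their sides
-- (a combinatorial map), together with its vertex set.
record Triangulation : Set where
  field
    F    : ℕ
    glue : Dart F → Dart F           -- side pairing (orientation-reversing gluing)
    glue-invol : ∀ s → glue (glue s) ≡ s
    glue-nofix : ∀ s → ¬ (glue s ≡ s)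
    V    : ℕ
    vert : Dart F → Fin V
  -- Gluing side (t,i) to side (u,j) identifies corner i of t with corner j+1 of u;
  -- rot c is the next corner around the same vertex.
  rot : Dart F → Dart F
  rot c = proj₁ (glue c) , next3 (proj₂ (glue c))
  field
    vert-rot   : ∀ c → vert (rot c) ≡ vert c
    vert-orbit : ∀ c d → vert c ≡ vert d → ∃ λ k → iter k rot c ≡ d
    vert-surj  : ∀ (x : Fin V) → ∃ λ c → vert c ≡ x
    connected  : ∀ c d → Reach glue c d
    -- Euler characteristic 2:  V - E + F = 2 with 2E = 3F
    euler      : 2 * V ≡ F + 4

  degree : Fin V → ℕ
  degree x = sumFin F (λ t → countFin 3 (λ i → vert (t , i) ≟F x))

bool→ℕ : Bool → ℕ
bool→ℕ true  = 1
bool→ℕ false = 0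

module _ (T : Triangulation) where
  open Triangulation T

  blackAt : (Fin F → Bool) → Fin V → ℕ
  blackAt col x = sumFin F (λ t → countFin 3 (λ i → vert (t , i) ≟F x)
                                   * bool→ℕ (col t))

  whiteAt : (Fin F → Bool) → Fin V → ℕ
  whiteAt col x = blackAt (λ t → not (col t)) x

  IsGood : (Fin F → Bool) → Set
  IsGood col = ∀ x → blackAt col x % 3 ≡ whiteAt col x % 3

  foldCount : (Fin F → Bool) → ℕ
  foldCount col = sumFin F (λ t → countFin 3 (λ i →
                    notEq (col t) (col (proj₁ (glue (t , i)))))) / 2
    where
    notEq : (a b : Bool) → Dec (¬ (a ≡ b))
    notEq a b with a ≟B b
    ... | yes p = no (λ q → q p)
    ... | no  q = yes q

module Submission where

-- Around a vertex of degree 6 the number of black triangles is 0, 3 or 6, and the two triangles at a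
-- vertex of degree 2 have different colours.  Hence a monochromatic run of 3 triangles around a vertex
-- is followed by a monochromatic run of 3 triangles, so the components of each colour class are locally
-- convex.  They contain no infinite straight strip of triangles: all strips parallel to such a strip
-- would be monochromatic too, they would sweep out the whole connected surface, and none of them can
-- pass a vertex of degree 2.  So each component unfolds to a hexagon (with some sides possibly of
-- length 0) in the triangular lattice, a stack of rows whose lengths change by at most 1 at each step,
-- and Gauss-Bonnet modulo 6 shows that this hexagon is embedded in the surface.  A hexagon with
-- perimeter p has at most p² / 6 triangles.  Summing over components, each colour class has at most
-- f² / 6 triangles, since all of its boundary edges are folds and every fold bounds both classes.

open import Defs
open import Algebra.Properties.CommutativeSemigroup using (interchange)
open import Data.Bool using (Bool; true; false; not; _∧_; _∨_)
open import Data.Bool.Properties using () renaming (_≟_ to _≟B_)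
open import Data.Empty using (⊥; ⊥-elim)
open import Data.Fin using (Fin; zero; suc; toℕ; fromℕ<; combine)
open import Data.Fin.Properties using (pigeonhole; combine-injective; toℕ<n; toℕ-fromℕ<; toℕ-injective)
  renaming (_≟_ to _≟F_; suc-injective to sucF-injective)
open import Data.List using (List; []; _∷_; _++_; length; applyUpTo)
open import Data.List.Properties using (length-++; length-applyUpTo)
open import Data.List.Membership.Propositional using (_∈_)
open import Data.List.Membership.Propositional.Properties
  using (∈-++⁺ˡ; ∈-++⁺ʳ; ∈-++⁻; ∈-applyUpTo⁺; ∈-applyUpTo⁻)
open import Data.Nat
open import Data.Nat.DivMod using (m*n/n≡m)
open import Data.Nat.Properties
open import Data.Nat.Tactic.RingSolver using (solve; solve-∀)
open import Data.Product using (Σ; ∃; ∃₂; _×_; _,_; proj₁; proj₂)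
open import Data.Sum using (_⊎_; inj₁; inj₂)
open import Function using (_∘_; case_of_)
open import Relation.Binary.Definitions using (DecidableEquality; tri<; tri≈; tri>)
open import Relation.Binary.PropositionalEquality
open import Relation.Nullary using (¬_; Dec; yes; no; does; ¬?)
open import Relation.Nullary.Decidable using (dec-true; dec-false)

-- Finite sums

-- Since 2 divides 6, six rotations fix every corner, also at a vertex of degree 2. Hence the
-- translations of the flat triangular lattice can be written as total functions on darts, and their
-- lattice identities hold everywhere: hexagons are traced on the surface itself, step by step. The
-- price is that a traced hexagon may overlap itself. Repeated triangles are harmless, because a
-- list is at least as long as the set of its members, the direction in which the area bound is
-- used. A boundary traversed several times would be fatal: the true perimeter would be a proper
-- fraction of the traced one. Turning decides this. The traced hexagon turns by 6 in units of 60
-- degrees, while one period of its boundary turns by a positive multiple of 6. The constant comes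
-- from the regular hexagon, where 6 A = p². Applied to both colour classes the bound gives 6 F ≤ 2
-- f². Passing from components to a class costs nothing, since a sum of squares is at most the
-- square of the sum.

sumFin-cong : ∀ n {f h : Fin n → ℕ} → (∀ i → f i ≡ h i) → sumFin n f ≡ sumFin n h
sumFin-cong zero    e = refl
sumFin-cong (suc n) e = cong₂ _+_ (e zero) (sumFin-cong n (e ∘ suc))

sumFin-mono : ∀ n {f h : Fin n → ℕ} → (∀ i → f i ≤ h i) → sumFin n f ≤ sumFin n h
sumFin-mono zero    e = z≤n
sumFin-mono (suc n) e = +-mono-≤ (e zero) (sumFin-mono n (e ∘ suc))

sumFin-+ : ∀ n (f h : Fin n → ℕ) → sumFin n (λ i → f i + h i) ≡ sumFin n f + sumFin n h
sumFin-+ zero    f h = refl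
sumFin-+ (suc n) f h = trans (cong (f zero + h zero +_) (sumFin-+ n (f ∘ suc) (h ∘ suc)))
  (interchange +-commutativeSemigroup (f zero) (h zero) _ _)

sumFin-* : ∀ n k (f : Fin n → ℕ) → sumFin n (λ i → k * f i) ≡ k * sumFin n f
sumFin-* zero    k f = sym (*-zeroʳ k)
sumFin-* (suc n) k f = trans (cong (k * f zero +_) (sumFin-* n k (f ∘ suc)))
  (sym (*-distribˡ-+ k (f zero) _))

sumFin-zero : ∀ n → sumFin n (λ _ → 0) ≡ 0
sumFin-zero zero    = refl
sumFin-zero (suc n) = sumFin-zero n

sumFin-const : ∀ n k → sumFin n (λ _ → k) ≡ n * k
sumFin-const zero    k = refl
sumFin-const (suc n) k = cong (k +_) (sumFin-const n k)

sumFin-swap : ∀ m n (f : Fin m → Fin n → ℕ) →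
  sumFin m (λ i → sumFin n (f i)) ≡ sumFin n (λ j → sumFin m (λ i → f i j))
sumFin-swap zero    n f = sym (sumFin-zero n)
sumFin-swap (suc m) n f = trans (cong (sumFin n (f zero) +_) (sumFin-swap m n (f ∘ suc)))
  (sym (sumFin-+ n (f zero) _))

𝟙 : ∀ {A : Set} → Dec A → ℕ
𝟙 d = bool→ℕ (does d)

𝟙-yes : ∀ {A : Set} (d : Dec A) → A → 𝟙 d ≡ 1
𝟙-yes (yes _) a = refl
𝟙-yes (no ¬a) a = ⊥-elim (¬a a)

𝟙-no : ∀ {A : Set} (d : Dec A) → ¬ A → 𝟙 d ≡ 0
𝟙-no (yes a) ¬a = ⊥-elim (¬a a)
𝟙-no (no _)  ¬a = refl

𝟙-⇔ : ∀ {A B : Set} (d : Dec A) (e : Dec B) → (A → B) → (B → A) → 𝟙 d ≡ 𝟙 e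
𝟙-⇔ (yes a) e f h = sym (𝟙-yes e (f a))
𝟙-⇔ (no ¬a) e f h = sym (𝟙-no e (¬a ∘ h))

𝟙-× : ∀ {A B C : Set} (d : Dec A) (e : Dec B) (z : Dec C) → (A → B → C) → (C → A × B) →
  𝟙 d * 𝟙 e ≡ 𝟙 z
𝟙-× (yes a) (yes b) z f h = sym (𝟙-yes z (f a b))
𝟙-× (yes a) (no ¬b) z f h = sym (𝟙-no z (¬b ∘ proj₂ ∘ h))
𝟙-× (no ¬a) e       z f h = sym (𝟙-no z (¬a ∘ proj₁ ∘ h))

sumFin-δ : ∀ n (j : Fin n) (f : Fin n → ℕ) → sumFin n (λ i → 𝟙 (i ≟F j) * f i) ≡ f j
sumFin-δ (suc n) zero f = begin
  1 * f zero + sumFin n (λ i → 0)  ≡⟨ cong₂ _+_ (*-identityˡ (f zero)) (sumFin-zero n) ⟩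
  f zero + 0                       ≡⟨ +-identityʳ _ ⟩
  f zero                           ∎
  where open ≡-Reasoning
sumFin-δ (suc n) (suc j) f = trans
  (sumFin-cong n (λ i → cong (_* f (suc i)) (𝟙-⇔ (suc i ≟F suc j) (i ≟F j) sucF-injective (cong suc))))
  (sumFin-δ n j (f ∘ suc))

countFin-𝟙 : ∀ n {P : Fin n → Set} (P? : ∀ i → Dec (P i)) → countFin n P? ≡ sumFin n (λ i → 𝟙 (P? i))
countFin-𝟙 n P? = trans (proj₂ terms) (sumFin-cong n same)
  where
  terms : Σ (Fin n → ℕ) λ h → countFin n P? ≡ sumFin n h
  -- The summand is local to `countFin`, so it is recovered by unification.
  terms = _ , refl
  same : ∀ i → proj₁ terms i ≡ 𝟙 (P? i)
  same i with P? i
  ... | yes _ = refl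
  ... | no  _ = refl

countFin>0 : ∀ n {P : Fin n → Set} (P? : ∀ i → Dec (P i)) → 0 < countFin n P? → ∃ P
countFin>0 n {P} P? 0<c = go n P? (subst (0 <_) (countFin-𝟙 n P?) 0<c)
  where
  go : ∀ n {P : Fin n → Set} (P? : ∀ i → Dec (P i)) → 0 < sumFin n (λ i → 𝟙 (P? i)) → ∃ P
  go (suc n) P? lt with P? zero
  ... | yes p = zero , p
  ... | no  _ with go n (P? ∘ suc) lt
  ...   | i , p = suc i , p

-- Sums over darts

module Darts (F : ℕ) where
  _≟D_ : (d e : Dart F) → Dec (d ≡ e)
  (t , i) ≟D (u , j) with t ≟F u | i ≟F j
  ... | yes refl | yes refl = yes refl
  ... | yes _    | no  ¬p   = no λ { refl → ¬p refl }
  ... | no  ¬p   | _        = no λ { refl → ¬p refl }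

  ∑ : (Dart F → ℕ) → ℕ
  ∑ f = sumFin F (λ t → sumFin 3 (λ i → f (t , i)))

  ∑-cong : ∀ {f h : Dart F → ℕ} → (∀ d → f d ≡ h d) → ∑ f ≡ ∑ h
  ∑-cong e = sumFin-cong F (λ t → sumFin-cong 3 (λ i → e (t , i)))

  ∑-+ : ∀ f h → ∑ (λ d → f d + h d) ≡ ∑ f + ∑ h
  ∑-+ f h = trans (sumFin-cong F (λ t → sumFin-+ 3 (λ i → f (t , i)) (λ i → h (t , i)))) (sumFin-+ F _ _)

  ∑-* : ∀ k f → ∑ (λ d → k * f d) ≡ k * ∑ f
  ∑-* k f = trans (sumFin-cong F (λ t → sumFin-* 3 k (λ i → f (t , i)))) (sumFin-* F k _)

  ∑-swap : ∀ n (f : Dart F → Fin n → ℕ) →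
    ∑ (λ d → sumFin n (f d)) ≡ sumFin n (λ j → ∑ (λ d → f d j))
  ∑-swap n f = trans (sumFin-cong F (λ t → sumFin-swap 3 n (λ i → f (t , i)))) (sumFin-swap F n _)

  ∑-swap₂ : ∀ (f : Dart F → Dart F → ℕ) → ∑ (λ d → ∑ (f d)) ≡ ∑ (λ e → ∑ (λ d → f d e))
  ∑-swap₂ f = trans (∑-swap F (λ d u → sumFin 3 (λ j → f d (u , j))))
    (sumFin-cong F (λ u → ∑-swap 3 (λ d j → f d (u , j))))

  ∑-δ : ∀ a (f : Dart F → ℕ) → ∑ (λ d → 𝟙 (d ≟D a) * f d) ≡ f a
  ∑-δ (u , j) f = begin
    ∑ (λ d → 𝟙 (d ≟D (u , j)) * f d)
      ≡⟨ ∑-cong (λ d → cong (_* f d) (split d)) ⟨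
    ∑ (λ d → 𝟙 (proj₁ d ≟F u) * 𝟙 (proj₂ d ≟F j) * f d)
      ≡⟨ ∑-cong (λ d → *-assoc (𝟙 (proj₁ d ≟F u)) (𝟙 (proj₂ d ≟F j)) (f d)) ⟩
    ∑ (λ d → 𝟙 (proj₁ d ≟F u) * (𝟙 (proj₂ d ≟F j) * f d))
      ≡⟨ sumFin-cong F (λ t → sumFin-* 3 (𝟙 (t ≟F u)) (λ i → 𝟙 (i ≟F j) * f (t , i))) ⟩
    sumFin F (λ t → 𝟙 (t ≟F u) * sumFin 3 (λ i → 𝟙 (i ≟F j) * f (t , i)))
      ≡⟨ sumFin-δ F u _ ⟩
    sumFin 3 (λ i → 𝟙 (i ≟F j) * f (u , i))
      ≡⟨ sumFin-δ 3 j (λ i → f (u , i)) ⟩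
    f (u , j) ∎
    where
    open ≡-Reasoning
    split : ∀ d → 𝟙 (proj₁ d ≟F u) * 𝟙 (proj₂ d ≟F j) ≡ 𝟙 (d ≟D (u , j))
    split d = 𝟙-× (proj₁ d ≟F u) (proj₂ d ≟F j) (d ≟D (u , j))
      (λ { refl refl → refl }) (λ { refl → refl , refl })

  ∑-reindex : ∀ (π ρ : Dart F → Dart F) → (∀ d → π (ρ d) ≡ d) → (∀ d → ρ (π d) ≡ d) →
    ∀ f → ∑ (f ∘ π) ≡ ∑ f
  ∑-reindex π ρ πρ ρπ f = begin
    ∑ (λ d → f (π d))
      ≡⟨ ∑-cong (λ d → ∑-δ (π d) f) ⟨
    ∑ (λ d → ∑ (λ e → 𝟙 (e ≟D π d) * f e))
      ≡⟨ ∑-swap₂ (λ d e → 𝟙 (e ≟D π d) * f e) ⟩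
    ∑ (λ e → ∑ (λ d → 𝟙 (e ≟D π d) * f e))
      ≡⟨ ∑-cong (λ e → ∑-cong (λ d → cong (_* f e) (𝟙-⇔ (e ≟D π d) (d ≟D ρ e)
           (λ { refl → sym (ρπ d) }) (λ { refl → sym (πρ e) })))) ⟩
    ∑ (λ e → ∑ (λ d → 𝟙 (d ≟D ρ e) * f e))
      ≡⟨ ∑-cong (λ e → ∑-δ (ρ e) (λ _ → f e)) ⟩
    ∑ f ∎
    where open ≡-Reasoning

  -- Serves for the corners around a vertex and for the darts along the boundary of a component,
  -- both listed by iterating a map over one period.
  ∑-enumerate : ∀ r (a : Fin r → Dart F) → (∀ {j k} → a j ≡ a k → j ≡ k) →
    (Q : Dart F → Bool) → (∀ k → Q (a k) ≡ true) → (∀ d → Q d ≡ true → ∃ λ k → a k ≡ d) →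
    ∀ f → ∑ (λ d → bool→ℕ (Q d) * f d) ≡ sumFin r (f ∘ a)
  ∑-enumerate r a inj Q sound complete f = begin
    ∑ (λ d → bool→ℕ (Q d) * f d)
      ≡⟨ ∑-cong spread ⟩
    ∑ (λ d → sumFin r (λ k → 𝟙 (d ≟D a k) * f d))
      ≡⟨ ∑-swap r (λ d k → 𝟙 (d ≟D a k) * f d) ⟩
    sumFin r (λ k → ∑ (λ d → 𝟙 (d ≟D a k) * f d))
      ≡⟨ sumFin-cong r (λ k → ∑-δ (a k) f) ⟩
    sumFin r (f ∘ a) ∎
    where
    open ≡-Reasoning
    spread : ∀ d → bool→ℕ (Q d) * f d ≡ sumFin r (λ k → 𝟙 (d ≟D a k) * f d)
    spread d with Q d in eq
    ... | false = sym (trans (sumFin-cong r (λ k → cong (_* f d) (𝟙-no (d ≟D a k)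
                   (λ { refl → case (trans (sym eq) (sound k)) of λ () })))) (sumFin-zero r))
    ... | true with complete d eq
    ...   | k₀ , refl = trans (*-identityˡ _) (sym (trans
              (sumFin-cong r (λ k → cong (_* f d)
                  (𝟙-⇔ (d ≟D a k) (k ≟F k₀) (λ e → sym (inj e)) (cong a ∘ sym))))
              (sumFin-δ r k₀ (λ _ → f d))))

-- Iteration and periods

module _ {A : Set} (f : A → A) where
  iter-comm : ∀ k x → iter k f (f x) ≡ f (iter k f x)
  iter-comm zero    x = refl
  iter-comm (suc k) x = cong f (iter-comm k x)

  iter-+ : ∀ j k x → iter (j + k) f x ≡ iter j f (iter k f x)
  iter-+ zero    k x = refl
  iter-+ (suc j) k x = cong f (iter-+ j k x)

  iter-injective : (∀ {x y} → f x ≡ f y → x ≡ y) → ∀ k {x y} → iter k f x ≡ iter k f y → x ≡ y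
  iter-injective inj zero    e = e
  iter-injective inj (suc k) e = iter-injective inj k (inj e)

  iter-intertwines : ∀ {h : A → A} → (∀ x → f (h x) ≡ h (f x)) → ∀ k x → iter k f (h x) ≡ h (iter k f x)
  iter-intertwines c zero    x = refl
  iter-intertwines c (suc k) x = trans (cong f (iter-intertwines c k x)) (c _)

  record Period (a : A) (bound : ℕ) : Set where
    field
      r        : ℕ
      r>0      : 0 < r
      r≤bound  : r ≤ bound
      returns  : iter r f a ≡ a
      minimal  : ∀ i → 0 < i → i < r → iter i f a ≢ a

    distinct< : ∀ {i j} → i < j → j < r → iter i f a ≢ iter j f a
    distinct< {i} {j} i<j j<r e = minimal (r ∸ j + i) (<-≤-trans (m<n⇒0<n∸m j<r) (m≤m+n _ i))
      (subst (r ∸ j + i <_) (m∸n+n≡m (<⇒≤ j<r)) (+-monoʳ-< (r ∸ j) i<j)) (begin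
      iter (r ∸ j + i) f a         ≡⟨ iter-+ (r ∸ j) i a ⟩
      iter (r ∸ j) f (iter i f a)  ≡⟨ cong (iter (r ∸ j) f) e ⟩
      iter (r ∸ j) f (iter j f a)  ≡⟨ iter-+ (r ∸ j) j a ⟨
      iter (r ∸ j + j) f a         ≡⟨ cong (λ k → iter k f a) (m∸n+n≡m (<⇒≤ j<r)) ⟩
      iter r f a                   ≡⟨ returns ⟩
      a                            ∎)
      where open ≡-Reasoning

    distinct : ∀ {i j : Fin r} → iter (toℕ i) f a ≡ iter (toℕ j) f a → i ≡ j
    distinct {i} {j} e with <-cmp (toℕ i) (toℕ j)
    ... | tri< lt _ _ = ⊥-elim (distinct< lt (toℕ<n j) e)
    ... | tri≈ _ eq _ = toℕ-injective eq
    ... | tri> _ _ gt = ⊥-elim (distinct< gt (toℕ<n i) (sym e))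

    reduce : ∀ k → ∃ λ (j : Fin r) → iter (toℕ j) f a ≡ iter k f a
    reduce zero = fromℕ< r>0 , cong (λ i → iter i f a) (toℕ-fromℕ< r>0)
    reduce (suc k) with reduce k
    ... | j , e with suc (toℕ j) <? r
    ...   | yes lt = fromℕ< lt , trans (cong (λ i → iter i f a) (toℕ-fromℕ< lt)) (cong f e)
    ...   | no  ≮  = fromℕ< r>0 , trans (cong (λ i → iter i f a) (toℕ-fromℕ< r>0))
            (trans (sym returns) (trans (cong (λ i → iter i f a) (≤-antisym (≮⇒≥ ≮) (toℕ<n j))) (cong f e)))

  leastPeriod : DecidableEquality A → ∀ a p → 0 < p → iter p f a ≡ a → Period a p
  leastPeriod _≟_ a (suc p) 0<p e = search 0 p refl (λ i 0<i i<1 → ⊥-elim (<⇒≱ i<1 0<i))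
    where
    search : ∀ i k → i + k ≡ p → (∀ j → 0 < j → j < suc i → iter j f a ≢ a) → Period a (suc p)
    search i k       eq low with iter (suc i) f a ≟ a
    ... | yes ret = record { r = suc i ; r>0 = z<s ; r≤bound = s≤s (subst (i ≤_) eq (m≤m+n i k))
                           ; returns = ret ; minimal = low }
    search i zero    eq low | no ¬ret =
      ⊥-elim (¬ret (trans (cong (λ j → iter (suc j) f a) (trans (sym (+-identityʳ i)) eq)) e))
    search i (suc k) eq low | no ¬ret = search (suc i) k (trans (sym (+-suc i k)) eq) low′
      where
      low′ : ∀ j → 0 < j → j < suc (suc i) → iter j f a ≢ a
      low′ j 0<j (s≤s j≤i) with m≤n⇒m<n∨m≡n j≤i
      ... | inj₁ lt   = low j 0<j lt
      ... | inj₂ refl = ¬ret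

module _ {F : ℕ} (f : Dart F → Dart F) (f-inj : ∀ {x y} → f x ≡ f y → x ≡ y) where
  -- Among F * 3 + 1 iterates two coincide, and injectivity cancels the initial segment, so the
  -- orbit is a cycle through `a` itself.
  dartPeriod : ∀ a → Period f a (F * 3)
  dartPeriod a with pigeonhole (n<1+n (F * 3)) (λ k → let d = iter (toℕ k) f a in combine (proj₁ d) (proj₂ d))
  ... | i , j , i<j , e = record { Period P ; r≤bound = ≤-trans (Period.r≤bound P) (≤-trans (m∸n≤m (toℕ j) (toℕ i)) (≤-pred (toℕ<n j))) }
    where
    open ≡-Reasoning
    same : iter (toℕ i) f a ≡ iter (toℕ j) f a
    same = cong₂ _,_ (proj₁ q) (proj₂ q)
      where q = combine-injective _ _ _ _ e
    P = leastPeriod f (Darts._≟D_ F) a (toℕ j ∸ toℕ i) (m<n⇒0<n∸m i<j)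
      (sym (iter-injective f f-inj (toℕ i) (begin
        iter (toℕ i) f a                             ≡⟨ same ⟩
        iter (toℕ j) f a                             ≡⟨ cong (λ k → iter k f a) (m+[n∸m]≡n (<⇒≤ i<j)) ⟨
        iter (toℕ i + (toℕ j ∸ toℕ i)) f a           ≡⟨ iter-+ f (toℕ i) _ a ⟩
        iter (toℕ i) f (iter (toℕ j ∸ toℕ i) f a)    ∎)))

-- Colours around a vertex

next : ∀ {F} → Dart F → Dart F
next d = proj₁ d , next3 (proj₂ d)

next³ : ∀ {F} (d : Dart F) → next (next (next d)) ≡ d
next³ (t , zero)          = refl
next³ (t , suc zero)       = refl
next³ (t , suc (suc zero)) = refl

balanced₂ : ∀ a b → (bool→ℕ a + (bool→ℕ b + 0)) % 3 ≡ (bool→ℕ (not a) + (bool→ℕ (not b) + 0)) % 3 → a ≢ b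
balanced₂ true  true  () refl
balanced₂ false false () refl

-- Three equal colours contribute 3 or -3 to black minus white, so the other three must contribute a
-- multiple of 3. A sum of three signs is 1 or -1 unless the signs agree.
balanced₆ : ∀ a x y z →
  let β = bool→ℕ ; ν = λ b → bool→ℕ (not b) in
  (β a + (β a + (β a + (β x + (β y + (β z + 0)))))) % 3 ≡ (ν a + (ν a + (ν a + (ν x + (ν y + (ν z + 0))))))
      % 3 →
  x ≡ y × x ≡ z
balanced₆ _     true  true  true  _ = refl , refl
balanced₆ _     false false false _ = refl , refl
balanced₆ true  true  true  false ()
balanced₆ true  true  false true  ()
balanced₆ true  true  false false ()
balanced₆ true  false true  true  ()
balanced₆ true  false true  false ()
balanced₆ true  false false true  ()
balanced₆ false true  true  false ()
balanced₆ false true  false true  ()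
balanced₆ false true  false false ()
balanced₆ false false true  true  ()
balanced₆ false false true  false ()
balanced₆ false false false true  ()

module Local (T : Triangulation) (col : Fin (Triangulation.F T) → Bool) (good : IsGood T col)
  (deg : ∀ x → Triangulation.degree T x ≡ 2 ⊎ Triangulation.degree T x ≡ 6) where
  open Triangulation T
  open Darts F

  degree-∑ : ∀ x → degree x ≡ ∑ (λ d → 𝟙 (vert d ≟F x))
  degree-∑ x = sumFin-cong F (λ t → countFin-𝟙 3 (λ i → vert (t , i) ≟F x))

  blackAt-∑ : ∀ κ x → blackAt T κ x ≡ ∑ (λ d → 𝟙 (vert d ≟F x) * bool→ℕ (κ (proj₁ d)))
  blackAt-∑ κ x = sumFin-cong F λ t → begin
    countFin 3 (λ i → vert (t , i) ≟F x) * bool→ℕ (κ t)           ≡⟨ cong (_* bool→ℕ (κ t))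
        (countFin-𝟙 3 (λ i → vert (t , i) ≟F x)) ⟩
    sumFin 3 (λ i → 𝟙 (vert (t , i) ≟F x)) * bool→ℕ (κ t)         ≡⟨ *-comm _ (bool→ℕ (κ t)) ⟩
    bool→ℕ (κ t) * sumFin 3 (λ i → 𝟙 (vert (t , i) ≟F x))         ≡⟨ sumFin-* 3 (bool→ℕ (κ t))
        (λ i → 𝟙 (vert (t , i) ≟F x)) ⟨
    sumFin 3 (λ i → bool→ℕ (κ t) * 𝟙 (vert (t , i) ≟F x))         ≡⟨ sumFin-cong 3
        (λ i → *-comm (bool→ℕ (κ t)) (𝟙 (vert (t , i) ≟F x))) ⟩
    sumFin 3 (λ i → 𝟙 (vert (t , i) ≟F x) * bool→ℕ (κ t))         ∎
    where open ≡-Reasoning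

  R : Dart F → Dart F
  R = rot

  R⁻ : Dart F → Dart F
  R⁻ d = glue (next (next d))

  RR⁻ : ∀ d → R (R⁻ d) ≡ d
  RR⁻ d = trans (cong next (glue-invol _)) (next³ d)

  R⁻R : ∀ d → R⁻ (R d) ≡ d
  R⁻R d = trans (cong glue (next³ _)) (glue-invol d)

  R-injective : ∀ {x y} → R x ≡ R y → x ≡ y
  R-injective {x} {y} e = trans (sym (R⁻R x)) (trans (cong R⁻ e) (R⁻R y))

  vert-iter : ∀ k d → vert (iter k R d) ≡ vert d
  vert-iter zero    d = refl
  vert-iter (suc k) d = trans (vert-rot _) (vert-iter k d)

  module _ (d : Dart F) where
    open Period (dartPeriod R R-injective d)

    ∑-around : ∀ f → ∑ (λ e → 𝟙 (vert e ≟F vert d) * f e) ≡ sumFin r (λ k → f (iter (toℕ k) R d))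
    ∑-around f = ∑-enumerate r (λ k → iter (toℕ k) R d) distinct (λ e → does (vert e ≟F vert d))
      (λ k → dec-true (vert (iter (toℕ k) R d) ≟F vert d) (vert-iter (toℕ k) d)) complete f
      where
      complete : ∀ e → does (vert e ≟F vert d) ≡ true → ∃ λ (k : Fin r) → iter (toℕ k) R d ≡ e
      complete e q with vert e ≟F vert d
      ... | yes p with vert-orbit d e (sym p)
      ...   | k , refl = reduce k

    -- By `vert-orbit` the corners at a vertex form a single cycle of the rotation. This turns the
    -- hypothesis on degrees into relations for `R`.
    degree≡r : degree (vert d) ≡ r
    degree≡r = begin
      degree (vert d)                             ≡⟨ degree-∑ (vert d) ⟩
      ∑ (λ e → 𝟙 (vert e ≟F vert d))              ≡⟨ ∑-cong (λ e → *-identityʳ (𝟙 (vert e ≟F vert d))) ⟨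
      ∑ (λ e → 𝟙 (vert e ≟F vert d) * 1)          ≡⟨ ∑-around (λ _ → 1) ⟩
      sumFin r (λ _ → 1)                          ≡⟨ sumFin-const r 1 ⟩
      r * 1                                       ≡⟨ *-identityʳ r ⟩
      r                                           ∎
      where open ≡-Reasoning

    blackAround : ∀ κ → blackAt T κ (vert d) ≡ sumFin r (λ k → bool→ℕ (κ (proj₁ (iter (toℕ k) R d))))
    blackAround κ = trans (blackAt-∑ κ (vert d)) (∑-around (λ e → bool→ℕ (κ (proj₁ e))))

    balanced : sumFin r (λ k → bool→ℕ (col (proj₁ (iter (toℕ k) R d)))) % 3
             ≡ sumFin r (λ k → bool→ℕ (not (col (proj₁ (iter (toℕ k) R d))))) % 3
    balanced = trans (cong (_% 3) (sym (blackAround col)))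
      (trans (good (vert d)) (cong (_% 3) (blackAround (not ∘ col))))

  colour : Dart F → Bool
  colour d = col (proj₁ d)

  Balanced : ℕ → Dart F → Set
  Balanced r d = sumFin r (λ k → bool→ℕ (colour (iter (toℕ k) R d))) % 3
               ≡ sumFin r (λ k → bool→ℕ (not (colour (iter (toℕ k) R d)))) % 3

  degree2 : ∀ d → degree (vert d) ≡ 2 → R (R d) ≡ d × colour d ≢ colour (R d)
  degree2 d e = go _ (Period.returns P) (balanced d) (trans (sym (degree≡r d)) e)
    where
    P = dartPeriod R R-injective d
    go : ∀ r → iter r R d ≡ d → Balanced r d → r ≡ 2 → R (R d) ≡ d × colour d ≢ colour (R d)
    go _ ret b refl = ret , balanced₂ _ _ b

  Opposite : Dart F → Set
  Opposite d = colour d ≡ colour (R d) → colour d ≡ colour (R (R d)) →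
    colour (iter 3 R d) ≡ colour (iter 4 R d) × colour (iter 3 R d) ≡ colour (iter 5 R d)

  degree6 : ∀ d → degree (vert d) ≡ 6 → iter 6 R d ≡ d × Opposite d
  degree6 d e = go _ (Period.returns P) (balanced d) (trans (sym (degree≡r d)) e)
    where
    P = dartPeriod R R-injective d
    rule : Balanced 6 d → Opposite d
    rule b p q = balanced₆ (colour d) x y z (subst₂ (λ u v →
      (bool→ℕ (colour d) + (bool→ℕ u + (bool→ℕ v + (bool→ℕ x + (bool→ℕ y + (bool→ℕ z + 0)))))) % 3
      ≡ (bool→ℕ (not (colour d)) + (bool→ℕ (not u) +
          (bool→ℕ (not v) + (bool→ℕ (not x) + (bool→ℕ (not y) + (bool→ℕ (not z) + 0)))))) % 3)
      (sym p) (sym q) b)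
      where
      x = colour (iter 3 R d)
      y = colour (iter 4 R d)
      z = colour (iter 5 R d)
    go : ∀ r → iter r R d ≡ d → Balanced r d → r ≡ 6 → iter 6 R d ≡ d × Opposite d
    go _ ret b refl = ret , rule b

  R⁶ : ∀ d → iter 6 R d ≡ d
  R⁶ d with deg (vert d)
  ... | inj₂ e = proj₁ (degree6 d e)
  ... | inj₁ e = let two = proj₁ (degree2 d e) in
    trans (cong (iter 4 R) two) (trans (cong (iter 2 R) two) two)

  opposite : ∀ d → Opposite d
  opposite d p q with deg (vert d)
  ... | inj₂ e = proj₂ (degree6 d e) p q
  ... | inj₁ e = ⊥-elim (proj₂ (degree2 d e) p)

-- Lattice translations and monochromatic strips

module Moves (T : Triangulation) (col : Fin (Triangulation.F T) → Bool) (good : IsGood T col)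
  (deg : ∀ x → Triangulation.degree T x ≡ 2 ⊎ Triangulation.degree T x ≡ 6) where
  open Triangulation T
  open Darts F
  open Local T col good deg

  R⁵ : ∀ d → iter 5 R d ≡ R⁻ d
  R⁵ d = trans (sym (R⁻R _)) (cong R⁻ (R⁶ d))

  R⁴ : ∀ d → iter 4 R d ≡ R⁻ (R⁻ d)
  R⁴ d = trans (sym (R⁻R _)) (cong R⁻ (R⁵ d))

  -- In the developed triangular lattice X, U and U′ translate a dart by one unit in the direction of
  -- the dart turned counterclockwise by 0, 60 and 120 degrees (R turns clockwise by 60 degrees).
  X U U′ : Dart F → Dart F
  X d  = R (R (next d))
  U d  = R⁻ (glue (next d))
  U′ d = glue (next (R⁻ d))

  XU′ : ∀ d → X (U′ d) ≡ U d
  XU′ d = trans (R⁴ (next (next d))) (cong (λ e → R⁻ (glue (next e))) (next³ d))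

  UX : ∀ d → U (X d) ≡ X (U d)
  UX d = begin
    R⁻ (R⁻ (glue (R (next d))))      ≡⟨ R⁴ (glue (R (next d))) ⟨
    iter 3 R (R (glue (R (next d)))) ≡⟨ cong (λ e → iter 3 R (next e)) (glue-invol (R (next d))) ⟩
    X (U d)                          ∎
    where open ≡-Reasoning

  -- In the lattice the head of `U d` is the apex of the triangle on `X d`, four clockwise steps
  -- away from the triangle on `U d`.
  U-apex : ∀ d → iter 4 R (next (U d)) ≡ next (next (X d))
  U-apex d = begin
    iter 5 R (next (next (glue (next d))))  ≡⟨ R⁵ _ ⟩
    R⁻ (next (next (glue (next d))))        ≡⟨ cong (λ e → glue (next e)) (next³ (glue (next d))) ⟩
    glue (R (next d))                       ≡⟨ next³ _ ⟨
    next (next (X d))                       ∎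
    where open ≡-Reasoning

  U′-apex : ∀ d → iter 4 R (next (U′ d)) ≡ next (next d)
  U′-apex d = R⁶ (next (next d))

  X⁻ : Dart F → Dart F
  X⁻ d = next (next (R⁻ (R⁻ d)))

  X⁻X : ∀ d → X⁻ (X d) ≡ d
  X⁻X d = trans (cong (λ e → next (next (R⁻ e))) (R⁻R (R (next d))))
    (trans (cong (λ e → next (next e)) (R⁻R (next d))) (next³ d))

  X-injective : ∀ {d e} → X d ≡ X e → d ≡ e
  X-injective {d} {e} p = trans (sym (X⁻X d)) (trans (cong X⁻ p) (X⁻X e))

  Straight : Bool → Dart F → Set
  Straight c d = colour d ≡ c × colour (R (next d)) ≡ c

  Strip : Bool → Dart F → Set
  Strip c d = ∀ i → Straight c (iter i X d)

  -- The orbits of `X` are cycles of length at most F * 3, so a strip of that length repeats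
  -- forever.
  longStrip : ∀ {c d} → (∀ i → i < F * 3 → Straight c (iter i X d)) → Strip c d
  longStrip {c} {d} s i with Period.reduce (dartPeriod X X-injective d) i
  ... | j , e = subst (Straight c) e
      (s (toℕ j) (<-≤-trans (toℕ<n j) (Period.r≤bound (dartPeriod X X-injective d))))

  X-predecessor : ∀ d → ∃ λ j → X (iter j X d) ≡ d
  X-predecessor d with Period.r P | Period.r>0 P | Period.returns P
    where P = dartPeriod X X-injective d
  ... | suc j | _ | e = j , e

  -- Here `h` reverses the direction of travel. As the orbits of `X` are cycles, a step backwards is
  -- also a number of steps forwards, so a property of all forward iterates covers it.
  X-reversed : (h : Dart F → Dart F) → (∀ d → X (h (X d)) ≡ h d) →
    ∀ d i → ∃ λ j → iter i X (h d) ≡ h (X (iter j X d))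
  X-reversed h rev d zero = let j , e = X-predecessor d in j , cong h (sym e)
  X-reversed h rev d (suc i) with X-reversed h rev d i
  ... | suc j , e = j , trans (cong X e) (rev _)
  ... | zero  , e = let j , e′ = X-predecessor d in j , trans (cong X e) (trans (rev d) (cong h (sym e′)))

  -- The top side of the inverted triangle to the right of `d`: the same strip after a half turn.
  flip : Dart F → Dart F
  flip d = next (R (next d))

  X-flip : ∀ d → X (flip (X d)) ≡ flip d
  X-flip d = begin
    R (R (next (next (R (next (X d))))))       ≡⟨⟩
    R (R (next (next (next (glue (next (X d))))))) ≡⟨ cong (R ∘ R) (next³ _) ⟩
    R (R (glue (next (X d))))                  ≡⟨ cong (R ∘ next) (glue-invol (next (X d))) ⟩
    R (next (next (next (glue (R (next d)))))) ≡⟨ cong R (next³ _) ⟩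
    R (glue (R (next d)))                      ≡⟨ cong next (glue-invol (R (next d))) ⟩
    next (R (next d))                          ∎
    where open ≡-Reasoning

  flip-across : ∀ d → R (next (flip d)) ≡ next (next d)
  flip-across d = trans (cong R (next³ (glue (next d)))) (cong next (glue-invol (next d)))

  flip-Strip : ∀ {c d} → Strip c d → Strip c (flip d)
  flip-Strip {c} {d} s i with X-reversed flip X-flip d i
  ... | j , e rewrite e = proj₂ (s (suc j)) , trans (cong colour (flip-across (X (iter j X d))))
      (proj₁ (s (suc j)))

  X-glue : ∀ d → X (glue (X d)) ≡ glue d
  X-glue d = begin
    R (R (R (X d)))         ≡⟨⟩
    iter 5 R (next d)       ≡⟨ R⁵ (next d) ⟩
    R⁻ (next d)             ≡⟨ cong glue (next³ d) ⟩
    glue d                  ∎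
    where open ≡-Reasoning

  R⁵next : ∀ d → iter 5 R (next d) ≡ glue d
  R⁵next d = trans (R⁵ (next d)) (cong glue (next³ d))

  -- The strip has three consecutive triangles at the head of `d`, so the three beneath them share a
  -- colour, possibly not `c`.
  Strip-step : ∀ {c d} → Strip c d → colour (glue (X d)) ≡ colour (glue d) ×
      colour (R (next (glue (X d)))) ≡ colour (glue d)
  Strip-step {c} {d} s with opposite (next d) (trans (proj₁ (s 0)) (sym (proj₂ (s 0))))
      (trans (proj₁ (s 0)) (sym (proj₁ (s 1))))
  ... | p , q = trans q e , trans (sym p) (trans q e)
    where
    e : colour (iter 5 R (next d)) ≡ colour (glue d)
    e = cong colour (R⁵next d)

  Strip-X : ∀ {c d} → Strip c d → ∀ i → Strip c (iter i X d)
  Strip-X {c} {d} s i j = subst (Straight c) (iter-+ X j i d) (s (j + i))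

  glue-Strip : ∀ {c d} → Strip c d → Strip (colour (glue d)) (glue d)
  glue-Strip {c} {d} s i with X-reversed glue X-glue d i
  ... | j , e rewrite e = along (suc j) , trans (proj₂ (Strip-step (Strip-X s j))) (along j)
    where
    along : ∀ j → colour (glue (iter j X d)) ≡ colour (glue d)
    along zero    = refl
    along (suc j) = trans (proj₁ (Strip-step (Strip-X s j))) (along j)

  InStrip : Fin F → Set
  InStrip t = ∃₂ λ i c → Strip c (t , i)

  inStrip : ∀ {c} d → Strip c d → InStrip (proj₁ d)
  inStrip d s = proj₂ d , _ , s

  sides : ∀ (t : Fin F) (i j : Fin 3) → (P : Dart F → Set) →
    P (t , i) → P (next (t , i)) → P (next (next (t , i))) → P (t , j)
  sides t zero zero P a b c = a
  sides t zero (suc zero) P a b c = b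
  sides t zero (suc (suc zero)) P a b c = c
  sides t (suc zero) zero P a b c = c
  sides t (suc zero) (suc zero) P a b c = a
  sides t (suc zero) (suc (suc zero)) P a b c = b
  sides t (suc (suc zero)) zero P a b c = b
  sides t (suc (suc zero)) (suc zero) P a b c = c
  sides t (suc (suc zero)) (suc (suc zero)) P a b c = a

  R⁻X : ∀ d → R⁻ (X d) ≡ R (next d)
  R⁻X d = R⁻R (R (next d))

  -- Crossing the side that runs along the strip leads into the parallel strip. Crossing either
  -- other side stays in the strip, seen upside down.
  inStrip-glue : ∀ d → InStrip (proj₁ d) → InStrip (proj₁ (glue d))
  inStrip-glue (t , j) (i , c , s) = sides t i j (InStrip ∘ proj₁ ∘ glue)
    (inStrip _ (glue-Strip s))
    (inStrip _ (flip-Strip s))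
    (let k , e = X-predecessor (t , i) in
      subst (InStrip ∘ proj₁) (trans (sym (R⁻X _)) (cong R⁻ e)) (inStrip _ (flip-Strip (Strip-X s k))))

  inStrip-reach : ∀ {c d} → InStrip (proj₁ c) → Reach glue c d → InStrip (proj₁ d)
  inStrip-reach s here                = s
  inStrip-reach s (step-glue {d} r)   = inStrip-glue d (inStrip-reach s r)
  inStrip-reach s (step-next r)       = inStrip-reach s r

  Strip-sides : ∀ {c d} → Strip c d → colour (glue (next d)) ≡ colour d × colour (R⁻ d) ≡ colour d
  Strip-sides {c} {d} s = trans (proj₂ (s 0)) (sym (proj₁ (s 0))) ,
    (let k , e = X-predecessor d in
      trans (cong colour (trans (cong R⁻ (sym e)) (R⁻X _))) (trans (proj₂ (s k)) (sym (proj₁ (s 0)))))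

  -- A triangle at a vertex of degree 2 has two sides where the colour changes, so no strip crosses it.
  noStrip-degree2 : ∀ d → degree (vert d) ≡ 2 → ¬ InStrip (proj₁ d)
  noStrip-degree2 d two (i , c , s) =
    sides (proj₁ d) i (proj₂ d) (λ e → colour e ≢ colour (glue e) → colour e ≢ colour (R⁻ e) → ⊥)
      (λ _ q → q (sym (proj₂ (Strip-sides s))))
      (λ p _ → p (sym (proj₁ (Strip-sides s))))
      (λ p q → p (sym (proj₂ (Strip-sides s))))
      (proj₂ (degree2 d two))
      (λ q → proj₂ (degree2 d two) (trans q
          (cong colour (trans (cong R⁻ (sym (proj₁ (degree2 d two)))) (R⁻R (R d))))))

  module _ (x : Fin V) (two : degree x ≡ 2) where
    noStrip : ∀ c d → ¬ (∀ i → i < F * 3 → Straight c (iter i X d))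
    noStrip c d s with vert-surj x
    ... | e , refl = noStrip-degree2 e two (inStrip-reach (inStrip d (longStrip s)) (connected d e))

-- Isoperimetry of lattice hexagons

2ab≤a²+b² : ∀ a b → 2 * (a * b) ≤ a * a + b * b
2ab≤a²+b² a b with ≤-total a b
... | inj₁ a≤b with m≤n⇒∃[o]m+o≡n a≤b
...   | o , refl = begin
  2 * (a * (a + o))               ≤⟨ m≤m+n _ (o * o) ⟩
  2 * (a * (a + o)) + o * o       ≡⟨ solve (a ∷ o ∷ []) ⟩
  a * a + (a + o) * (a + o)       ∎
  where open ≤-Reasoning
2ab≤a²+b² a b | inj₂ b≤a with m≤n⇒∃[o]m+o≡n b≤a
...   | o , refl = begin
  2 * ((b + o) * b)               ≤⟨ m≤m+n _ (o * o) ⟩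
  2 * ((b + o) * b) + o * o       ≡⟨ solve (b ∷ o ∷ []) ⟩
  (b + o) * (b + o) + b * b       ∎
  where open ≤-Reasoning

-- Inv s c u A bounds the area A of a cap on a base of length c with u further boundary edges whose
-- rows widen by at most s - 1.  For s = 0 the cap is a truncated triangle; the inequalities for
-- s = 1, 2 come from maximising the area over the remaining freedom in its shape.
Inv : ℕ → ℕ → ℕ → ℕ → Set
Inv 0             c u A = ∃ λ y → u + y ≡ 2 * c × A + y * y ≡ c * c
Inv 1             c u A = 4 * A + 3 * (c * c) ≤ 4 * (c * u)
Inv (suc (suc _)) c u A = 7 * A + 7 * (c * c) ≤ (u + 2 * c) * (u + 2 * c)

Inv-flat : ∀ c → Inv 0 c c 0
Inv-flat c = c , solve (c ∷ []) , refl

-- The slack is the square of c - 2 y, where `y` is the length of the top of the truncated triangle.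
Inv₀⇒₁ : ∀ c u A → Inv 0 c u A → Inv 1 c u A
Inv₀⇒₁ c u A (y , p , q) = +-cancelʳ-≤ (4 * (y * y) + 4 * (c * y)) _ _ (begin
  4 * A + 3 * (c * c) + (4 * (y * y) + 4 * (c * y))   ≡⟨ solve (A ∷ c ∷ y ∷ []) ⟩
  4 * (A + y * y) + 3 * (c * c) + 2 * (c * (2 * y))   ≡⟨ cong
      (λ z → 4 * z + 3 * (c * c) + 2 * (c * (2 * y))) q ⟩
  4 * (c * c) + 3 * (c * c) + 2 * (c * (2 * y))       ≤⟨ +-monoʳ-≤ (4 * (c * c) + 3 * (c * c))
      (2ab≤a²+b² c (2 * y)) ⟩
  4 * (c * c) + 3 * (c * c) + (c * c + 2 * y * (2 * y)) ≡⟨ solve (c ∷ y ∷ []) ⟩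
  4 * (c * (2 * c)) + 4 * (y * y)                     ≡⟨ cong (λ z → 4 * (c * z) + 4 * (y * y)) p ⟨
  4 * (c * (u + y)) + 4 * (y * y)                     ≡⟨ solve (c ∷ u ∷ y ∷ []) ⟩
  4 * (c * u) + (4 * (y * y) + 4 * (c * y))           ∎)
  where open ≤-Reasoning

-- After multiplication by 4 the slack is the square of 2 u - 3 c.
Inv₁⇒₂ : ∀ c u A → Inv 1 c u A → Inv 2 c u A
Inv₁⇒₂ c u A p = *-cancelˡ-≤ 4 (+-cancelʳ-≤ (21 * (c * c)) _ _ (begin
  4 * (7 * A + 7 * (c * c)) + 21 * (c * c)               ≡⟨ solve (A ∷ c ∷ []) ⟩
  7 * (4 * A + 3 * (c * c)) + 28 * (c * c)               ≤⟨ +-monoˡ-≤ (28 * (c * c)) (*-monoʳ-≤ 7 p) ⟩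
  7 * (4 * (c * u)) + 28 * (c * c)                       ≡⟨ solve (c ∷ u ∷ []) ⟩
  2 * ((2 * u) * (3 * c)) + (16 * (c * u) + 28 * (c * c)) ≤⟨ +-monoˡ-≤ _ (2ab≤a²+b² (2 * u) (3 * c)) ⟩
  (2 * u) * (2 * u) + (3 * c) * (3 * c) + (16 * (c * u) + 28 * (c * c)) ≡⟨ solve (c ∷ u ∷ []) ⟩
  4 * ((u + 2 * c) * (u + 2 * c)) + 21 * (c * c)         ∎))
  where open ≤-Reasoning

Inv-weaken : ∀ {s s′} c u A → s ≤ s′ → Inv s c u A → Inv s′ c u A
Inv-weaken {0}     {0}           c u A _ i = i
Inv-weaken {0}     {1}           c u A _ i = Inv₀⇒₁ c u A i
Inv-weaken {0}     {suc (suc _)} c u A _ i = Inv₁⇒₂ c u A (Inv₀⇒₁ c u A i)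
Inv-weaken {1}     {1}           c u A _ i = i
Inv-weaken {1}     {suc (suc _)} c u A _ i = Inv₁⇒₂ c u A i
Inv-weaken {suc (suc _)} {suc (suc _)} c u A _ i = i
Inv-weaken {suc (suc _)} {1} c u A (s≤s ()) i

-- The three forms of `Inv` are adapted to adding a row below. For s = 0 the same `y` serves; for s
-- = 1 both sides grow by 8 c; for s = 2 the quantities A + c² and u + 2 c do not change.
Inv-row : ∀ s k u A → s ≤ 2 → Inv s (s + k) u A → Inv s (suc k) (2 + u) (suc k + (s + k) + A)
Inv-row 0 k u A _ (y , p , q) = y , trans (cong (2 +_) p) (solve (k ∷ [])) ,
  (begin
  suc k + k + A + y * y   ≡⟨ +-assoc (suc k + k) A (y * y) ⟩
  suc k + k + (A + y * y) ≡⟨ cong (suc k + k +_) q ⟩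
  suc k + k + k * k       ≡⟨ solve (k ∷ []) ⟩
  suc k * suc k           ∎)
  where open ≡-Reasoning
Inv-row 1 k u A _ p = begin
  4 * (suc k + suc k + A) + 3 * (suc k * suc k)   ≡⟨ solve (k ∷ A ∷ []) ⟩
  8 * suc k + (4 * A + 3 * (suc k * suc k))       ≤⟨ +-monoʳ-≤ (8 * suc k) p ⟩
  8 * suc k + 4 * (suc k * u)                     ≡⟨ solve (k ∷ u ∷ []) ⟩
  4 * (suc k * (2 + u))                           ∎
  where open ≤-Reasoning
Inv-row 2 k u A _ p = begin
  7 * (suc k + (2 + k) + A) + 7 * (suc k * suc k)     ≡⟨ solve (k ∷ A ∷ []) ⟩
  7 * A + 7 * ((2 + k) * (2 + k))                     ≤⟨ p ⟩
  (u + 2 * (2 + k)) * (u + 2 * (2 + k))               ≡⟨ solve (k ∷ u ∷ []) ⟩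
  (2 + u + 2 * suc k) * (2 + u + 2 * suc k)           ∎
  where open ≤-Reasoning
Inv-row (suc (suc (suc _))) k u A (s≤s (s≤s ())) p

-- After multiplication by 7 the slack is the square of u - 5 c, which vanishes for the regular
-- hexagon.
isoperimetric : ∀ {s} c u A → s ≤ 2 → Inv s c u A → 6 * A ≤ (c + u) * (c + u)
isoperimetric c u A s≤2 i = *-cancelˡ-≤ 7 (+-cancelʳ-≤ (10 * (c * u) + 42 * (c * c)) _ _ (begin
  7 * (6 * A) + (10 * (c * u) + 42 * (c * c))        ≡⟨ solve (A ∷ c ∷ u ∷ []) ⟩
  6 * (7 * A + 7 * (c * c)) + 2 * (u * (5 * c))      ≤⟨ +-mono-≤ (*-monoʳ-≤ 6 (Inv-weaken c u A s≤2 i))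
      (2ab≤a²+b² u (5 * c)) ⟩
  6 * ((u + 2 * c) * (u + 2 * c)) + (u * u + 5 * c * (5 * c)) ≡⟨ solve (c ∷ u ∷ []) ⟩
  7 * ((c + u) * (c + u)) + (10 * (c * u) + 42 * (c * c)) ∎))
  where open ≤-Reasoning

-- Boundary turns and rows of one colour

module Rows (T : Triangulation) (col : Fin (Triangulation.F T) → Bool) (good : IsGood T col)
  (deg : ∀ x → Triangulation.degree T x ≡ 2 ⊎ Triangulation.degree T x ≡ 6) (c : Bool) where
  open Triangulation T
  open Darts F
  open Local T col good deg
  open Moves T col good deg

  B : Dart F → Set
  B d = colour d ≡ c

  B? : ∀ d → Dec (B d)
  B? d = colour d ≟B c

  -- A run of three corners of colour `c` stops at both ends or at neither, and in the latter case
  -- it fills the vertex. This excludes reflex boundary angles.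
  convex : ∀ x → B x → B (R x) → B (R (R x)) → colour (iter 3 R x) ≡ colour (R⁻ x)
  convex x p q r = trans (proj₂ (opposite x (trans p (sym q)) (trans p (sym r)))) (cong colour (R⁵ x))

  -- TurnAt x s y: the boundary of the region of colour c continues from dart x with dart y,
  -- turning left by s times 60 degrees.
  data TurnAt (x : Dart F) : ℕ → Dart F → Set where
    sharp : ¬ B (R (next x)) → TurnAt x 2 (next x)
    blunt : B (R (next x)) → ¬ B (R (R (next x))) → TurnAt x 1 (R (next x))
    flat  : B (R (next x)) → B (R (R (next x))) → TurnAt x 0 (X x)

  turnAt : ∀ x → ∃₂ (TurnAt x)
  turnAt x with B? (R (next x)) | B? (R (R (next x)))
  ... | no ¬p | _     = 2 , _ , sharp ¬p
  ... | yes p | no ¬q = 1 , _ , blunt p ¬q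
  ... | yes p | yes q = 0 , _ , flat p q

  β : Dart F → Dart F
  β x = proj₁ (proj₂ (turnAt x))

  τ : Dart F → ℕ
  τ x = proj₁ (turnAt x)

  turn-unique : ∀ {x s y s′ y′} → TurnAt x s y → TurnAt x s′ y′ → s ≡ s′ × y ≡ y′
  turn-unique (sharp _)   (sharp _)    = refl , refl
  turn-unique (sharp p)   (blunt q _)  = ⊥-elim (p q)
  turn-unique (sharp p)   (flat q _)   = ⊥-elim (p q)
  turn-unique (blunt q _) (sharp p)    = ⊥-elim (p q)
  turn-unique (blunt _ _) (blunt _ _)  = refl , refl
  turn-unique (blunt _ p) (flat _ q)   = ⊥-elim (p q)
  turn-unique (flat q _)  (sharp p)    = ⊥-elim (p q)
  turn-unique (flat _ q)  (blunt _ p)  = ⊥-elim (p q)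
  turn-unique (flat _ _)  (flat _ _)   = refl , refl

  turn-β : ∀ {x s y} → TurnAt x s y → τ x ≡ s × β x ≡ y
  turn-β {x} t = turn-unique (proj₂ (proj₂ (turnAt x))) t

  Fold : Dart F → Set
  Fold x = B x × ¬ B (glue x)

  -- Only the straight angle needs an argument: there `convex` ties the triangle across the new dart
  -- to the one across `x`.
  turn-Fold : ∀ {x s y} → Fold x → TurnAt x s y → Fold y
  turn-Fold (b , _) (sharp p)    = b , p
  turn-Fold _       (blunt p q)  = p , q
  turn-Fold {x} (b , ¬b) (flat p q) = q , λ r → ¬b (trans (sym (trans (convex (next x) b p q)
    (cong colour (cong glue (next³ x))))) r)

  -- The turn at the head of the first dart is counted and the one at the head of the last is not,
  -- so turnings add under concatenation and a closed walk counts each turn once.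
  data Walk : Dart F → ℕ → ℕ → Dart F → Set where
    stop : ∀ {x} → Walk x 0 0 x
    _∷_  : ∀ {x s y k s′ z} → TurnAt x s y → Walk y k s′ z → Walk x (suc k) (s + s′) z

  _⋆_ : ∀ {x k s y k′ s′ z} → Walk x k s y → Walk y k′ s′ z → Walk x (k + k′) (s + s′) z
  stop ⋆ v = v
  _⋆_ {x} {suc k} {k′ = k′} {z = z} (_∷_ {s = s} t w) v = subst (λ a → Walk x (suc (k + k′)) a z)
      (sym (+-assoc s _ _)) (t ∷ (w ⋆ v))

  On : Dart F → ℕ → Dart F → Set
  On x k z = ∃ λ i → i ≤ k × iter i β x ≡ z

  walk-iter : ∀ {x k s z} → Walk x k s z → iter k β x ≡ z
  walk-iter stop = refl
  walk-iter {x} {suc k} (t ∷ w) = trans (sym (iter-comm β k x))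
      (trans (cong (iter k β) (proj₂ (turn-β t))) (walk-iter w))

  on-end : ∀ {x k s z} → Walk x k s z → On x k z
  on-end {k = k} w = k , ≤-refl , walk-iter w

  on-skip : ∀ {x k s y m z} → Walk x k s y → On y m z → On x (k + m) z
  on-skip {x} {k} {m = m} w (i , i≤m , refl) = i + k , subst (i + k ≤_) (+-comm m k) (+-monoˡ-≤ k i≤m) ,
    trans (iter-+ β i k x) (cong (iter i β) (walk-iter w))

  on-mono : ∀ {x k m z} → k ≤ m → On x k z → On x m z
  on-mono k≤m (i , i≤k , e) = i , ≤-trans i≤k k≤m , e

  -- For `over`, an inverted triangle sticks out beyond the first upright one: the boundary leans
  -- outwards as it rises, and the top line starts one unit further left, at `U′ D` instead of
  -- `U D`.
  data LeftEnd (D : Dart F) : ℕ → Dart F → Dart F → Set where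
    flush : ¬ B (R⁻ D) → LeftEnd D 0 (next (next D)) (U D)
    over  : B (R⁻ D) → ¬ B (R⁻ (R⁻ D)) → LeftEnd D 1 (next (next (R⁻ D))) (U′ D)

  data RightEnd (E : Dart F) : ℕ → Dart F → Set where
    flush : ¬ B (R (next E)) → RightEnd E 0 (next E)
    over  : B (R (next E)) → ¬ B (R (R (next E))) → RightEnd E 1 (R (next E))

  left≤1 : ∀ {D l λ′ D′} → LeftEnd D l λ′ D′ → l ≤ 1
  left≤1 (flush _)  = z≤n
  left≤1 (over _ _) = s≤s z≤n

  right≤1 : ∀ {E r ρ} → RightEnd E r ρ → r ≤ 1
  right≤1 (flush _)  = z≤n
  right≤1 (over _ _) = s≤s z≤n

  -- A maximal row of triangles of colour c with bottom sides D, X D, …, X^k D.  It begins at the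
  -- left fold lf and ends at the right fold rf; its top sides, seen from above, are the l + (r + k)
  -- translates of D′.
  record Row (D : Dart F) (k l r : ℕ) (lf rf D′ : Dart F) : Set where
    field
      left  : LeftEnd D l lf D′
      ups   : ∀ i → i ≤ k → B (iter i X D)
      mids  : ∀ i → i < k → B (R (next (iter i X D)))
      right : RightEnd (iter k X D) r rf

    width : ℕ
    width = l + (r + k)

    downs : ∀ i → i < r + k → B (R (next (iter i X D)))
    downs i i< with right
    ... | flush _  = mids i i<
    ... | over p _ with m≤n⇒m<n∨m≡n (≤-pred i<)
    ...   | inj₁ lt   = mids i lt
    ...   | inj₂ refl = p

    r+k≤1+k : r + k ≤ suc k
    r+k≤1+k = +-monoˡ-≤ k (right≤1 right)

    top-U : ∀ i → iter (l + i) X D′ ≡ U (iter i X D)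
    top-U i with left
    ... | flush _  = iter-intertwines X (λ x → sym (UX x)) i D
    ... | over _ _ = trans (sym (iter-comm X i (U′ D))) (trans (cong (iter i X) (XU′ D))
                       (iter-intertwines X (λ x → sym (UX x)) i D))

    data Top : ℕ → Set where
      right-of : ∀ i → i < r + k → Top (l + i)
      leftmost : l ≡ 1 → D′ ≡ U′ D → B (R⁻ D) → lf ≡ next (next (R⁻ D)) → Top 0

    top : ∀ j → j < width → Top j
    top j j< with left | right-of | leftmost
    ... | flush _  | ro | _ = ro j j<
    top zero    j<       | over p _ | _  | lm = lm refl refl p refl
    top (suc j) (s≤s j<) | over _ _ | ro | _  = ro j j<

    below : ∀ j → j < width → B (glue (iter j X D′))
    below j j< with top j j<
    ... | right-of i i< = trans (cong colour (trans (cong glue (top-U i)) (glue-invol _))) (downs i i<)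
    ... | leftmost _ e p _ = trans (cong colour (trans (cong glue e) (glue-invol _))) p

    apex : ∀ j → suc j < width → B (iter 4 R (next (iter j X D′)))
    apex j j< with top j (<-trans (n<1+n j) j<)
    ... | right-of i _ = trans (cong colour (trans (cong (iter 4 R ∘ next) (top-U i)) (U-apex _)))
            (ups (suc i) (≤-pred (<-≤-trans
                (+-cancelˡ-< l (suc i) (r + k) (subst (_< width) (sym (+-suc l i)) j<)) r+k≤1+k)))
    ... | leftmost _ e _ _ = trans (cong colour (trans (cong (iter 4 R ∘ next) e) (U′-apex D))) (ups 0 z≤n)

    -- An inner vertex of the top line meets three consecutive triangles of the row (inverted,
    -- upright, inverted), so the three above it share a colour. Along the line this means that the
    -- row is continued everywhere or nowhere.
    above : ∀ j → suc j < width → let y = iter j X D′ in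
      colour (R (next y)) ≡ colour y × colour (X y) ≡ colour y
    above j j< = trans (sym (trans (proj₁ o) e₄)) e₃ , trans (sym (trans (proj₂ o) e₅)) e₃
      where
      y z : Dart F
      y = iter j X D′
      z = iter 3 R (next y)
      o = opposite z (trans (below (suc j) j<) (sym (apex j j<)))
            (trans (below (suc j) j<) (sym (trans (cong colour (R⁵next y)) (below j (<-trans (n<1+n j) j<)))))
      e₃ : colour (iter 3 R z) ≡ colour y
      e₃ = cong colour (R⁶ (next y))
      e₄ : colour (iter 4 R z) ≡ colour (R (next y))
      e₄ = cong (colour ∘ R) (R⁶ (next y))
      e₅ : colour (iter 5 R z) ≡ colour (X y)
      e₅ = cong (colour ∘ R ∘ R) (R⁶ (next y))

    above-all : ∀ j → j < width → colour (iter j X D′) ≡ colour D′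
    above-all zero    j< = refl
    above-all (suc j) j< = trans (proj₂ (above j j<)) (above-all j (<-trans (n<1+n j) j<))

    -- Without an overhang on the right, the last top side belongs to the inverted triangle to the
    -- left of the last upright one. It exists unless the row is a single triangle.
    R⁻-last : l + (r + k) ≢ 0 → r ≡ 0 → B (R⁻ (iter k X D))
    R⁻-last w≢0 refl = go k refl
      where
      go : ∀ i → i ≡ k → B (R⁻ (iter i X D))
      go (suc i) refl = trans (cong colour (R⁻X _)) (mids i ≤-refl)
      go zero refl with left
      ... | flush _  = ⊥-elim (w≢0 refl)
      ... | over p _ = p

  U′X : ∀ d → U′ (X d) ≡ U d
  U′X d = X-injective (trans (XU′ (X d)) (UX d))

  data LastTop (E : Dart F) : ℕ → Dart F → Set where
    flush : B (R⁻ E) → LastTop E 0 (U′ E)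
    over  : LastTop E 1 (U E)

  lastTop : ∀ {D k l r lf rf D′ k′} (row : Row D k l r lf rf D′) → Row.width row ≡ suc k′ →
    LastTop (iter k X D) r (iter k′ X D′)
  lastTop {D} {k} {l} {r} {D′ = D′} {k′} row w = go r refl
    where
    open Row row
    index : ∀ i → l + suc i ≡ suc k′ → iter k′ X D′ ≡ U (iter i X D)
    index i e = trans (cong (λ j → iter j X D′) (suc-injective (trans (sym e) (+-suc l i)))) (top-U i)
    B-last : r ≡ 0 → B (R⁻ (iter k X D))
    B-last = R⁻-last (λ e → case trans (sym w) e of λ ())
    go : ∀ r′ → r′ ≡ r → LastTop (iter k X D) r′ (iter k′ X D′)
    go 0 refl = subst (LastTop _ 0) (U′-last k refl w) (flush (B-last refl))
      where
      U′-last : ∀ i → i ≡ k → l + i ≡ suc k′ → U′ (iter i X D) ≡ iter k′ X D′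
      U′-last (suc i) refl e = trans (U′X _) (sym (index i e))
      U′-last zero    refl e with left | e
      ... | over _ _ | refl = refl
    go 1 refl = subst (LastTop _ 1) (sym (index k w)) over
    go (suc (suc _)) refl with right≤1 right
    ... | s≤s ()

  record NextLeft (D′ : Dart F) (l : ℕ) (lf : Dart F) : Set where
    field
      {l′ s}   : ℕ
      {lf′ D″} : Dart F
      left′    : LeftEnd D′ l′ lf′ D″
      turn     : TurnAt lf′ s lf
      turned   : s + l′ ≡ l

  -- Overhang is traded for turning: the left boundary may lean outwards for a while, turn, and lean
  -- inwards from then on. After a flush end, an overhang of the next row would by `convex` force an
  -- overhang of this one.
  nextLeft : ∀ {D l lf D′} → LeftEnd D l lf D′ → B D → (l ≡ 0 → B (R (next D))) → B D′ → NextLeft D′ l lf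
  nextLeft {D} (flush ¬p) b r b′ = record
    { left′ = flush λ q → ¬p (trans (sym e₃) (trans (convex (U D) b′ (trans (cong colour e₁) (r refl)) (trans (cong colour e₂) b)) q))
    ; turn = subst (TurnAt (next (next (U D))) 0) (trans (cong (R ∘ R) (next³ (U D))) e₂)
        (flat (trans (cong (colour ∘ R) (next³ (U D))) (trans (cong colour e₁) (r refl)))
              (trans (cong (colour ∘ R ∘ R) (next³ (U D))) (trans (cong colour e₂) b)))
    ; turned = refl }
    where
    e₁ : R (U D) ≡ glue (next D)
    e₁ = RR⁻ (glue (next D))
    e₂ : R (R (U D)) ≡ next (next D)
    e₂ = trans (cong R e₁) (cong next (glue-invol (next D)))
    e₃ : colour (iter 3 R (U D)) ≡ colour (R⁻ D)
    e₃ = cong (colour ∘ R) e₂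
  nextLeft {D} (over p ¬q) b r b′ with B? (R⁻ (U′ D))
  ... | no ¬p′ = record
    { left′ = flush ¬p′
    ; turn = subst (TurnAt (next (next (U′ D))) 1) (trans (cong R (next³ (U′ D))) e)
        (blunt (trans (cong (colour ∘ R) (next³ (U′ D))) (trans (cong colour e) p))
               λ q → ¬q (trans (sym (cong (colour ∘ R) (trans (cong R (next³ (U′ D))) e))) q))
    ; turned = refl }
    where
    e : R (U′ D) ≡ next (next (R⁻ D))
    e = cong next (glue-invol (next (R⁻ D)))
  ... | yes p′ = record
    { left′ = over p′ λ q → ¬q (trans (sym (cong (colour ∘ R) e₂)) (trans (convex (R⁻ (U′ D)) p′ (trans (cong colour e₁) b′)
        (trans (cong colour e₂) p)) q))
    ; turn = subst (TurnAt (next (next (R⁻ (U′ D)))) 0) (trans (cong (R ∘ R) (next³ (R⁻ (U′ D)))) e₂)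
        (flat (trans (cong (colour ∘ R) (next³ (R⁻ (U′ D)))) (trans (cong colour e₁) b′))
              (trans (cong (colour ∘ R ∘ R) (next³ (R⁻ (U′ D)))) (trans (cong colour e₂) p)))
    ; turned = refl }
    where
    e₁ : R (R⁻ (U′ D)) ≡ U′ D
    e₁ = RR⁻ (U′ D)
    e₂ : R (R (R⁻ (U′ D))) ≡ next (next (R⁻ D))
    e₂ = trans (cong R e₁) (cong next (glue-invol (next (R⁻ D))))

  record NextRight (E′ : Dart F) (r : ℕ) (rf : Dart F) : Set where
    field
      {r′ s} : ℕ
      {rf′}  : Dart F
      right′ : RightEnd E′ r′ rf′
      turn   : TurnAt rf s rf′
      turned : s + r′ ≡ r

  flush-top : ∀ E → R (next (next E)) ≡ glue (U′ E)
  flush-top E = sym (glue-invol _)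

  over-top : ∀ E → next (R (next E)) ≡ glue (U E)
  over-top E = sym (glue-invol _)

  nextRight : ∀ {E r rf E′} → RightEnd E r rf → B E → LastTop E r E′ → B E′ → NextRight E′ r rf
  nextRight {E} (flush ¬p) b (flush q) b′ = record
    { right′ = flush λ s → ¬p (trans (sym (cong (colour ∘ glue) (next³ (next E)))) (trans (sym (convex (next (next E)) b q (trans (cong colour e) b′))) (trans (cong (colour ∘ R) e) s)))
    ; turn = subst (TurnAt (next E) 0) e (flat q (trans (cong colour e) b′))
    ; turned = refl }
    where
    e : R (R (next (next E))) ≡ next (U′ E)
    e = cong next (trans (cong glue (flush-top E)) (glue-invol _))
  nextRight {E} (over p ¬q) b over b′ with B? (R (next (U E)))
  ... | no ¬p′ = record
    { right′ = flush ¬p′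
    ; turn = subst (TurnAt (R (next E)) 1) e
          (blunt (trans (cong colour e) b′) λ q → ¬p′ (trans (sym (cong (colour ∘ R) e)) q))
    ; turned = refl }
    where
    e : R (next (R (next E))) ≡ next (U E)
    e = cong next (trans (cong glue (over-top E)) (glue-invol _))
  ... | yes p′ = record
    { right′ = over p′ λ s → ¬q (trans (sym (cong (colour ∘ glue) (next³ (R (next E)))))
        (trans (sym (convex (next (R (next E))) p (trans (cong colour e) b′) (trans (cong (colour ∘ R) e) p′)))
          (trans (cong (colour ∘ R ∘ R) e) s)))
    ; turn = subst (TurnAt (R (next E)) 0) (cong R e)
          (flat (trans (cong colour e) b′) (trans (cong (colour ∘ R) e) p′))
    ; turned = refl }
    where
    e : R (next (R (next E))) ≡ next (U E)
    e = cong next (trans (cong glue (over-top E)) (glue-invol _))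

  -- Caps stacked from rows

  Closed : (Fin F → Set) → Set
  Closed P = ∀ d → B (glue d) → P (proj₁ d) → P (proj₁ (glue d))

  -- The list `tris` may repeat triangles, as nothing yet makes the unfolding injective.
  -- Connectedness is expressed by `grown`, through all closed predicates. A walk of `steps` steps
  -- passes `suc steps` darts, the count entering `area`.
  record Cap (D : Dart F) (k l r : ℕ) (lf rf : Dart F) : Set₁ where
    field
      tris  : List (Fin F)
      steps : ℕ
      walk  : Walk rf steps (2 + (l + r)) lf
      base  : ∀ i → i ≤ k → proj₁ (iter i X D) ∈ tris
      edges : ∀ d → proj₁ d ∈ tris →
              proj₁ (glue d) ∈ tris ⊎ On rf steps d ⊎ ∃ λ i → i ≤ k × d ≡ iter i X D
      grown : ∀ P → Closed P → P (proj₁ D) → ∀ {t} → t ∈ tris → P t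
      area  : Inv (l + r) (suc k) (suc steps) (length tris)

  -- What closes a row from above: a point, a line of folds, or the cap of the next row. Here `u`
  -- counts the boundary darts strictly between `rf` and `lf`.
  record Lid (D′ : Dart F) (n l r : ℕ) (lf rf : Dart F) : Set₁ where
    field
      tris  : List (Fin F)
      u     : ℕ
      walk  : Walk rf (suc u) (2 + (l + r)) lf
      tops  : ∀ j → j < n → proj₁ (iter j X D′) ∈ tris ⊎ On rf (suc u) (glue (iter j X D′))
      edges : ∀ d → proj₁ d ∈ tris →
              proj₁ (glue d) ∈ tris ⊎ On rf (suc u) d ⊎ ∃ λ j → j < n × d ≡ iter j X D′
      grown : ∀ P → Closed P → (∀ j → j < n → P (proj₁ (glue (iter j X D′)))) → ∀ {t} → t ∈ tris → P t
      area  : Inv (l + r) n u (length tris)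

  module AddRow {D k l r lf rf D′} (row : Row D k l r lf rf D′)
    (lid : Lid D′ (l + (r + k)) l r lf rf) where
    open Row row
    open Lid lid

    upAt downAt : ℕ → Fin F
    upAt i = proj₁ (iter i X D)
    downAt j = proj₁ (glue (iter j X D′))

    upper lower tris⁺ : List (Fin F)
    lower = applyUpTo upAt (suc k)
    upper = applyUpTo downAt width
    tris⁺ = lower ++ (upper ++ tris)

    up∈ : ∀ i → i ≤ k → proj₁ (iter i X D) ∈ tris⁺
    up∈ i i≤ = ∈-++⁺ˡ (∈-applyUpTo⁺ upAt (s≤s i≤))

    down∈ : ∀ j → j < width → proj₁ (glue (iter j X D′)) ∈ tris⁺
    down∈ j j< = ∈-++⁺ʳ lower (∈-++⁺ˡ (∈-applyUpTo⁺ downAt j<))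

    lid∈ : ∀ {t} → t ∈ tris → t ∈ tris⁺
    lid∈ t∈ = ∈-++⁺ʳ lower (∈-++⁺ʳ upper t∈)

    right∈ : ∀ i → i < r + k → proj₁ (glue (next (iter i X D))) ∈ tris⁺
    right∈ i i< = subst (_∈ tris⁺) (cong proj₁ (trans (cong glue (top-U i)) (glue-invol _)))
      (down∈ (l + i) (+-monoʳ-< l i<))

    Edge : Dart F → Set
    Edge d = proj₁ (glue d) ∈ tris⁺ ⊎ On rf (suc u) d ⊎ ∃ λ i → i ≤ k × d ≡ iter i X D

    right-edge : ∀ i → i ≤ k → Edge (next (iter i X D))
    right-edge i i≤ with right | right∈ i
    ... | over _ _ | ri = inj₁ (ri (s≤s i≤))
    ... | flush _  | ri with m≤n⇒m<n∨m≡n i≤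
    ...   | inj₁ lt   = inj₁ (ri lt)
    ...   | inj₂ refl = inj₂ (inj₁ (0 , z≤n , refl))

    left-edge : ∀ i → i ≤ k → Edge (next (next (iter i X D)))
    left-edge (suc i) i≤ = inj₁ (subst (_∈ tris⁺) (cong proj₁ (sym (R⁻X (iter i X D))))
      (right∈ i (<-≤-trans i≤ (m≤n+m k r))))
    left-edge zero i≤ with left | on-end walk | down∈ 0
    ... | flush _  | on | _  = inj₂ (inj₁ on)
    ... | over _ _ | _  | d∈ = inj₁ (subst (_∈ tris⁺) (cong proj₁ (glue-invol _)) (d∈ z<s))

    top-edge : ∀ j → j < width → Edge (glue (iter j X D′))
    top-edge j j< with tops j j<
    ... | inj₁ t∈ = inj₁ (subst (_∈ tris⁺) (cong proj₁ (sym (glue-invol _))) (lid∈ t∈))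
    ... | inj₂ on = inj₂ (inj₁ on)

    beyond : ∀ i → i < r + k → Edge (R (next (iter i X D)))
    beyond i i< with m≤n⇒m<n∨m≡n (≤-pred (<-≤-trans i< r+k≤1+k))
    ... | inj₁ lt = inj₁ (up∈ (suc i) lt)
    ... | inj₂ refl with right
    ...   | flush _  = ⊥-elim (<-irrefl refl i<)
    ...   | over _ _ = inj₂ (inj₁ (0 , z≤n , refl))

    down-edges : ∀ j → j < width → let e = glue (iter j X D′) in Edge (next e) × Edge (next (next e))
    down-edges j j< with top j j<
    ... | right-of i i< =
      subst Edge (sym (trans (cong next e) (next³ _)))
        (inj₁ (subst (_∈ tris⁺) (cong proj₁ (sym (glue-invol _))) (up∈ i (≤-pred (<-≤-trans i< r+k≤1+k))))) ,
      subst Edge (sym (cong next (trans (cong next e) (next³ _)))) (beyond i i<)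
      where
      e : glue (iter (l + i) X D′) ≡ next (next (glue (next (iter i X D))))
      e = trans (cong glue (top-U i)) (glue-invol _)
    ... | leftmost _ e₀ p e₁ =
      subst Edge (sym (cong next e)) (inj₂ (inj₁ (subst (On rf (suc u)) e₁ (on-end walk)))) ,
      subst Edge (sym (trans (cong (next ∘ next) e) (next³ (R⁻ D))))
        (inj₁ (subst (_∈ tris⁺) (cong proj₁ (sym (glue-invol _))) (up∈ 0 z≤n)))
      where
      e : glue D′ ≡ next (R⁻ D)
      e = trans (cong glue e₀) (glue-invol _)

    edges⁺ : ∀ d → proj₁ d ∈ tris⁺ → Edge d
    edges⁺ (t , s) t∈ with ∈-++⁻ lower t∈
    ... | inj₁ t∈lower with ∈-applyUpTo⁻ upAt t∈lower
    ...   | i , s≤s i≤ , refl = sides _ (proj₂ (iter i X D)) s Edge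
            (inj₂ (inj₂ (i , i≤ , refl))) (right-edge i i≤) (left-edge i i≤)
    edges⁺ (t , s) t∈ | inj₂ t∈′ with ∈-++⁻ upper t∈′
    ... | inj₁ t∈upper with ∈-applyUpTo⁻ downAt t∈upper
    ...   | j , j< , refl = sides _ (proj₂ (glue (iter j X D′))) s Edge
            (top-edge j j<) (proj₁ (down-edges j j<)) (proj₂ (down-edges j j<))
    edges⁺ (t , s) t∈ | inj₂ t∈′ | inj₂ t∈lid with edges (t , s) t∈lid
    ... | inj₁ g∈                 = inj₁ (lid∈ g∈)
    ... | inj₂ (inj₁ on)          = inj₂ (inj₁ on)
    ... | inj₂ (inj₂ (j , j< , refl)) = inj₁ (down∈ j j<)

    module _ (P : Fin F → Set) (cl : Closed P) (p₀ : P (proj₁ D)) where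
      P-up : ∀ i → i ≤ k → P (proj₁ (iter i X D))
      P-up zero    _  = p₀
      P-up (suc i) i≤ = cl (R (next (iter i X D))) (ups (suc i) i≤)
        (cl (next (iter i X D)) (mids i i≤) (P-up i (<⇒≤ i≤)))

      P-down : ∀ j → j < width → P (proj₁ (glue (iter j X D′)))
      P-down j j< with top j j<
      ... | right-of i i< = subst P (cong proj₁ (sym (trans (cong glue (top-U i)) (glue-invol _))))
              (cl (next (iter i X D)) (downs i i<) (P-up i (≤-pred (<-≤-trans i< r+k≤1+k))))
      ... | leftmost _ e p _ = subst P (cong proj₁ (sym (trans (cong glue e) (glue-invol _))))
              (cl (next (next D)) p p₀)

      P-all : ∀ {t} → t ∈ tris⁺ → P t
      P-all t∈ with ∈-++⁻ lower t∈
      ... | inj₁ t∈lower with ∈-applyUpTo⁻ upAt t∈lower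
      ...   | i , s≤s i≤ , refl = P-up i i≤
      P-all t∈ | inj₂ t∈′ with ∈-++⁻ upper t∈′
      ... | inj₂ t∈lid = grown P cl P-down t∈lid
      ... | inj₁ t∈upper with ∈-applyUpTo⁻ downAt t∈upper
      ...   | j , j< , refl = P-down j j<

    length⁺ : length tris⁺ ≡ suc k + (l + r + k) + length tris
    length⁺ = begin
      length tris⁺                                        ≡⟨ length-++ lower ⟩
      length lower + length (upper ++ tris)               ≡⟨ cong₂ _+_ (length-applyUpTo upAt (suc k))
          (length-++ upper) ⟩
      suc k + (length upper + length tris)                ≡⟨ cong (λ m → suc k + (m + length tris))
          (length-applyUpTo downAt width) ⟩
      suc k + (l + (r + k) + length tris)                 ≡⟨ cong (λ m → suc k + (m + length tris))
          (+-assoc l r k) ⟨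
      suc k + (l + r + k + length tris)                   ≡⟨ +-assoc (suc k) (l + r + k) (length tris) ⟨
      suc k + (l + r + k) + length tris                   ∎
      where open ≡-Reasoning

    cap : Cap D k l r lf rf
    cap = record
      { tris  = tris⁺
      ; steps = suc u
      ; walk  = walk
      ; base  = up∈
      ; edges = edges⁺
      ; grown = P-all
      ; area  = subst (Inv (l + r) (suc k) (2 + u)) (sym length⁺)
          (Inv-row (l + r) k u (length tris) (+-mono-≤ (left≤1 left) (right≤1 right))
            (subst (λ n → Inv (l + r) n u (length tris)) (sym (+-assoc l r k)) area))
      }

  -- Width 0 leaves a lone upright triangle, whose folds `rf` and `lf` meet at the apex in a sharp
  -- turn.
  apexLid : ∀ {D k l r lf rf D′} → Row D k l r lf rf D′ → l + (r + k) ≡ 0 → Lid D′ (l + (r + k)) l r lf rf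
  apexLid {D} row w = go (Row.left row) (Row.right row) w
    where
    go : ∀ {k l r lf rf D′} → LeftEnd D l lf D′ → RightEnd (iter k X D) r rf → l + (r + k) ≡ 0 →
      Lid D′ (l + (r + k)) l r lf rf
    go {zero} (flush ¬p) (flush _) _ = record
      { tris  = []
      ; u     = 0
      ; walk  = sharp ¬p ∷ stop
      ; tops  = λ _ ()
      ; edges = λ _ ()
      ; grown = λ _ _ _ ()
      ; area  = Inv-flat 0
      }

  module _ {D k l r lf rf D′ k′} (row : Row D k l r lf rf D′) (w : Row.width row ≡ suc k′) where
    open Row row

    along-top : ¬ B D′ → ∀ j → j < suc k′ → ¬ B (iter j X D′)
    along-top ¬b j j< p = ¬b (trans (sym (above-all j (subst (j <_) (sym w) j<))) p)

    last-turn : ∀ {E r′ rf E′} → RightEnd E r′ rf → LastTop E r′ E′ → ¬ B E′ → TurnAt rf (1 + r′) (glue E′)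
    last-turn {E} (flush ¬p) (flush q) ¬b = subst (TurnAt (next E) 1) (flush-top E)
      (blunt q λ s → ¬b (trans (sym (cong colour (trans (cong glue (flush-top E)) (glue-invol _)))) s))
    last-turn {E} (over p ¬q) over ¬b = subst (TurnAt (R (next E)) 2) (over-top E)
      (sharp λ s → ¬b (trans (sym (cong colour (trans (cong glue (over-top E)) (glue-invol _)))) s))

    first-turn : ∀ {l′ lf D′} → LeftEnd D l′ lf D′ → (l′ ≡ 0 → B (R (next D))) → TurnAt (glue D′) (1 + l′) lf
    first-turn (flush ¬p) r = subst (TurnAt (glue (U D)) 1) e₂
      (blunt (trans (cong colour e₂) (ups 0 z≤n)) λ q → ¬p (trans (sym (cong (colour ∘ R) e₂)) q))
      where
      e₂ : R (R (U D)) ≡ next (next D)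
      e₂ = trans (cong R (RR⁻ (glue (next D)))) (cong next (glue-invol (next D)))
    first-turn (over p ¬q) r = subst (TurnAt (glue (U′ D)) 2) e
      (sharp λ s → ¬q (trans (sym (cong (colour ∘ R) e)) s))
      where
      e : R (U′ D) ≡ next (next (R⁻ D))
      e = cong next (glue-invol (next (R⁻ D)))

    top-turn : ∀ j → suc j ≤ k′ → TurnAt (glue (iter (suc j) X D′)) 0 (glue (iter j X D′))
    top-turn j j≤ = subst (TurnAt (glue (X y)) 0) (X-glue y)
      (flat (apex j j<) (trans (cong colour (R⁵next y)) (below j (<-trans (n<1+n j) j<))))
      where
      y : Dart F
      y = iter j X D′
      j< : suc j < width
      j< = subst (suc j <_) (sym w) (s≤s j≤)

    top-walk : ∀ j → j ≤ k′ → Walk (glue (iter j X D′)) j 0 (glue D′)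
    top-walk zero    _  = stop
    top-walk (suc j) j≤ = top-turn j j≤ ∷ top-walk j (<⇒≤ j≤)

    top-on : ∀ m → m ≤ k′ → ∀ j → j ≤ m → On (glue (iter m X D′)) m (glue (iter j X D′))
    top-on m       m≤ j j≤ with m≤n⇒m<n∨m≡n j≤
    ... | inj₂ refl = 0 , z≤n , refl
    top-on (suc m) m≤ j _ | inj₁ j< = on-skip (top-turn m m≤ ∷ stop) (top-on m (<⇒≤ m≤) j (≤-pred j<))

    right₀ : l ≡ 0 → B (R (next D))
    right₀ refl = downs 0 (subst (0 <_) (sym w) z<s)

    -- The whole top line consists of folds. The boundary turns into it by `1 + r` and out of it by
    -- `1 + l`, since an overhanging side meets it at the sharper angle.
    flatLid : ¬ B D′ → Lid D′ (suc k′) l r lf rf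
    flatLid ¬b = record
      { tris  = []
      ; u     = suc k′
      ; walk  = subst₂ (λ m s → Walk rf m s lf) (cong suc (+-comm k′ 1)) (turns l r)
          (t ∷ (top-walk k′ ≤-refl ⋆ (first-turn left right₀ ∷ stop)))
      ; tops  = λ j j< → inj₂ (on-mono (s≤s (n≤1+n k′)) (on-skip (t ∷ stop) (top-on k′ ≤-refl j (≤-pred j<))))
      ; edges = λ _ ()
      ; grown = λ _ _ _ ()
      ; area  = Inv-weaken (suc k′) (suc k′) 0 z≤n (Inv-flat (suc k′))
      }
      where
      turns : ∀ l r → 1 + r + (0 + (1 + l + 0)) ≡ 2 + (l + r)
      turns = solve-∀
      t : TurnAt rf (1 + r) (glue (iter k′ X D′))
      t = last-turn right (lastTop row w) (along-top ¬b k′ ≤-refl)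

    nextRow : B D′ → (nl : NextLeft D′ l lf) (nr : NextRight (iter k′ X D′) r rf) →
      Row D′ k′ (NextLeft.l′ nl) (NextRight.r′ nr) (NextLeft.lf′ nl) (NextRight.rf′ nr) (NextLeft.D″ nl)
    nextRow b nl nr = record
      { left  = NextLeft.left′ nl
      ; ups   = ups′
      ; mids  = λ i i< → trans (proj₁ (above i (subst (suc i <_) (sym w) (s≤s i<)))) (ups′ i (<⇒≤ i<))
      ; right = NextRight.right′ nr
      }
      where
      ups′ : ∀ i → i ≤ k′ → B (iter i X D′)
      ups′ i i≤ = trans (above-all i (subst (i <_) (sym w) (s≤s i≤))) b

  capLid : ∀ {D′ k′ l′ r′ lf′ rf′ l r lf rf s s′} → Cap D′ k′ l′ r′ lf′ rf′ → B D′ →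
    TurnAt lf′ s lf → s + l′ ≡ l → TurnAt rf s′ rf′ → s′ + r′ ≡ r → Lid D′ (suc k′) l r lf rf
  capLid {D′} {k′} {l′} {r′} {lf = lf} {rf} {s} {s′} cap b tl refl tr refl = record
    { tris  = tris
    ; u     = suc steps
    ; walk  = subst₂ (λ m σ → Walk rf m σ lf) (cong suc (+-comm steps 1)) (turns s s′ l′ r′)
        (tr ∷ (walk ⋆ (tl ∷ stop)))
    ; tops  = λ j j< → inj₁ (base j (≤-pred j<))
    ; edges = edges′
    ; grown = λ P cl p → grown P cl (subst (P ∘ proj₁) (glue-invol D′)
        (cl (glue D′) (trans (cong colour (glue-invol D′)) b) (p 0 z<s)))
    ; area  = Inv-weaken (suc k′) (suc steps) (length tris) (+-mono-≤ (m≤n+m l′ s) (m≤n+m r′ s′)) area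
    }
    where
    open Cap cap
    turns : ∀ s s′ l′ r′ → s′ + (2 + (l′ + r′) + (s + 0)) ≡ 2 + (s + l′ + (s′ + r′))
    turns = solve-∀
    edges′ : ∀ d → proj₁ d ∈ tris →
      proj₁ (glue d) ∈ tris ⊎ On rf (suc (suc steps)) d ⊎ ∃ λ j → j < suc k′ × d ≡ iter j X D′
    edges′ d t∈ with edges d t∈
    ... | inj₁ g∈                     = inj₁ g∈
    ... | inj₂ (inj₁ on)              = inj₂ (inj₁ (on-mono (n≤1+n _) (on-skip (tr ∷ stop) on)))
    ... | inj₂ (inj₂ (j , j≤ , e))    = inj₂ (inj₂ (j , s≤s j≤ , e))

  -- Everything but the recursion. The argument `rest` learns how the left boundary turned, from
  -- which its callers obtain termination.
  buildCap : ∀ {D k l r lf rf D′} → Row D k l r lf rf D′ →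
    (∀ {k′ l′ r′ lf′ rf′ D″ s} → Row D′ k′ l′ r′ lf′ rf′ D″ → TurnAt lf′ s lf → s + l′ ≡ l →
        Cap D′ k′ l′ r′ lf′ rf′) →
    Cap D k l r lf rf
  buildCap {D} {k} {l} {r} {lf} {rf} {D′} row rest = AddRow.cap row (go (width) refl)
    where
    open Row row
    go : ∀ n → width ≡ n → Lid D′ width l r lf rf
    go zero     w = apexLid row w
    go (suc k′) w = subst (λ n → Lid D′ n l r lf rf) (sym w) lid
      where
      lid : Lid D′ (suc k′) l r lf rf
      lid with B? D′
      ... | no ¬b = flatLid row w ¬b
      ... | yes b = capLid (rest (nextRow row w b nl nr) (NextLeft.turn nl) (NextLeft.turned nl)) b
                      (NextLeft.turn nl) (NextLeft.turned nl) (NextRight.turn nr) (NextRight.turned nr)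
        where
        nl = nextLeft left (ups 0 z≤n) (right₀ row w) b
        nr = nextRight right (ups k ≤-refl) (lastTop row w)
               (trans (above-all k′ (subst (k′ <_) (sym w) ≤-refl)) b)

  -- Finiteness of the stack of rows

  module _ (noStrip : ∀ d → ¬ (∀ i → i < F * 3 → Straight c (iter i X d))) where

    StraightFor : ℕ → Dart F → Set
    StraightFor m d = ∀ i → i < m → Straight c (iter i X d)

    straighten : ∀ {m d e} → TurnAt d 0 e → B d → StraightFor m e → StraightFor (suc m) d
    straighten (flat p _) b s zero    _  = b , p
    straighten {d = d} (flat p _) b s (suc i) i< = subst (Straight c) (iter-comm X i d) (s i (≤-pred i<))

    B-leftFold : ∀ {D k l r lf rf D′} → Row D k l r lf rf D′ → B lf
    B-leftFold row with Row.left row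
    ... | flush _  = Row.ups row 0 z≤n
    ... | over p _ = p

    -- A left boundary that never turns is as long as a monochromatic strip, so the rows run out.
    cap₀ : ∀ K m → m + K ≡ F * 3 → ∀ {D k r lf rf D′} → Row D k 0 r lf rf D′ → StraightFor m lf →
        Cap D k 0 r lf rf
    cap₀ zero m e row st = ⊥-elim (noStrip _ (λ i i< → st i (subst (i <_) (trans (sym e) (+-identityʳ m)) i<)))
    cap₀ (suc K) m e {D′ = D′} row st = buildCap row go
      where
      go : ∀ {k′ l′ r′ lf′ rf′ D″ s} → Row D′ k′ l′ r′ lf′ rf′ D″ → TurnAt lf′ s _ → s + l′ ≡ 0 →
          Cap D′ k′ l′ r′ lf′ rf′
      go {l′ = zero} {s = zero} row′ t refl = cap₀ K (suc m)
          (trans (sym (+-suc m K)) e) row′ (straighten t (B-leftFold row′) st)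

    -- The overhang on the left is lost at most once, and `cap₀` then starts with a fresh allowance
    -- of F * 3 rows.
    cap₁ : ∀ K m → m + K ≡ F * 3 → ∀ {D k r lf rf D′} → Row D k 1 r lf rf D′ → StraightFor m lf →
        Cap D k 1 r lf rf
    cap₁ zero m e row st = ⊥-elim (noStrip _ (λ i i< → st i (subst (i <_) (trans (sym e) (+-identityʳ m)) i<)))
    cap₁ (suc K) m e {D′ = D′} row st = buildCap row go
      where
      go : ∀ {k′ l′ r′ lf′ rf′ D″ s} → Row D′ k′ l′ r′ lf′ rf′ D″ → TurnAt lf′ s _ → s + l′ ≡ 1 →
          Cap D′ k′ l′ r′ lf′ rf′
      go {l′ = suc zero} {s = zero} row′ t refl = cap₁ K (suc m)
          (trans (sym (+-suc m K)) e) row′ (straighten t (B-leftFold row′) st)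
      go {l′ = suc zero} {s = suc s} row′ t e′ = ⊥-elim (m+1+n≢0 s (suc-injective e′))
      go {l′ = zero} {s = suc zero} row′ t refl = cap₀ (F * 3) 0 refl row′ (λ _ ())

    capOf : ∀ {D k l r lf rf D′} → Row D k l r lf rf D′ → Cap D k l r lf rf
    capOf {l = 0} row = cap₀ (F * 3) 0 refl row (λ _ ())
    capOf {l = 1} row = cap₁ (F * 3) 0 refl row (λ _ ())
    capOf {l = suc (suc _)} row with left≤1 (Row.left row)
    ... | s≤s ()

-- Gauss-Bonnet for regions of one colour

module GaussBonnet (T : Triangulation) (col : Fin (Triangulation.F T) → Bool) (good : IsGood T col)
  (deg : ∀ x → Triangulation.degree T x ≡ 2 ⊎ Triangulation.degree T x ≡ 6) (c : Bool) where
  open Triangulation T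
  open Darts F
  open Local T col good deg
  open Moves T col good deg
  open Rows T col good deg c

  ∑-next : ∀ f → ∑ (f ∘ next) ≡ ∑ f
  ∑-next = ∑-reindex next (next ∘ next) next³ next³

  ∑-R : ∀ f → ∑ (f ∘ R) ≡ ∑ f
  ∑-R = ∑-reindex R R⁻ RR⁻ R⁻R

  ∑-+₄ : ∀ f h i j → ∑ (λ d → f d + (h d + (i d + j d))) ≡ ∑ f + (∑ h + (∑ i + ∑ j))
  ∑-+₄ f h i j = trans (∑-+ f (λ d → h d + (i d + j d))) (cong (∑ f +_)
    (trans (∑-+ h (λ d → i d + j d)) (cong (∑ h +_) (∑-+ i j))))

  key : Dart F → ℕ
  key d = toℕ (combine (proj₁ d) (proj₂ d))

  key-injective : ∀ {d e} → key d ≡ key e → d ≡ e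
  key-injective eq with combine-injective _ _ _ _ (toℕ-injective eq)
  ... | p , q = cong₂ _,_ p q

  -- Each pair matched by `glue` is charged to its member with the smaller `key`.
  ∑-glue-even : ∀ e → (∀ d → e (glue d) ≡ e d) → ∃ λ m → ∑ e ≡ 2 * m
  ∑-glue-even e sym-e = ∑ lower , (begin
    ∑ e                              ≡⟨ ∑-cong halves ⟩
    ∑ (λ d → lower d + lower (glue d)) ≡⟨ ∑-+ lower (lower ∘ glue) ⟩
    ∑ lower + ∑ (lower ∘ glue)       ≡⟨ cong (∑ lower +_) (∑-reindex glue glue glue-invol glue-invol lower) ⟩
    ∑ lower + ∑ lower                ≡⟨ cong (∑ lower +_) (+-identityʳ _) ⟨
    2 * ∑ lower                      ∎)
    where
    open ≡-Reasoning
    lower : Dart F → ℕ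
    lower d = 𝟙 (key d <? key (glue d)) * e d
    halves : ∀ d → e d ≡ lower d + lower (glue d)
    halves d rewrite glue-invol d | sym-e d with <-cmp (key d) (key (glue d))
    ... | tri≈ _ eq _  = ⊥-elim (glue-nofix d (sym (key-injective eq)))
    ... | tri< lt _ ≯  = sym (trans
        (cong₂ (λ a b → a * e d + b * e d) (𝟙-yes (key d <? key (glue d)) lt) (𝟙-no (key (glue d) <? key d) ≯))
            (trans (+-identityʳ _) (+-identityʳ _)))
    ... | tri> ≮ _ gt  = sym (trans
        (cong₂ (λ a b → a * e d + b * e d) (𝟙-no (key d <? key (glue d)) ≮) (𝟙-yes (key (glue d) <? key d) gt))
            (+-identityʳ _))

  -- Grouped by vertices, the sum is degree times common value, and the value vanishes wherever the
  -- degree is not 6.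
  ∑-rot-invariant : ∀ (w : Dart F → ℕ) → (∀ d → w (R d) ≡ w d) → (∀ d → degree (vert d) ≡ 2 → w d ≡ 0) →
    ∃ λ v → ∑ w ≡ 6 * v
  ∑-rot-invariant w inv two = sumFin V at , (begin
    ∑ w                                                 ≡⟨ ∑-cong at-vert ⟩
    ∑ (λ d → at (vert d))                               ≡⟨ ∑-cong (λ d → sumFin-δ V (vert d) at) ⟨
    ∑ (λ d → sumFin V (λ x → 𝟙 (x ≟F vert d) * at x))   ≡⟨ ∑-swap V (λ d x → 𝟙 (x ≟F vert d) * at x) ⟩
    sumFin V (λ x → ∑ (λ d → 𝟙 (x ≟F vert d) * at x))   ≡⟨ sumFin-cong V around ⟩
    sumFin V (λ x → 6 * at x)                           ≡⟨ sumFin-* V 6 at ⟩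
    6 * sumFin V at                                     ∎)
    where
    open ≡-Reasoning
    at : Fin V → ℕ
    at x = w (proj₁ (vert-surj x))
    w-iter : ∀ k d → w (iter k R d) ≡ w d
    w-iter zero    d = refl
    w-iter (suc k) d = trans (inv _) (w-iter k d)
    at-vert : ∀ d → w d ≡ at (vert d)
    at-vert d with vert-orbit (proj₁ (vert-surj (vert d))) d (proj₂ (vert-surj (vert d)))
    ... | k , e = trans (cong w (sym e)) (w-iter k _)
    six : ∀ x → degree x * at x ≡ 6 * at x
    six x with deg x
    ... | inj₂ e = cong (_* at x) e
    ... | inj₁ e = trans (cong (degree x *_) z) (trans (*-zeroʳ (degree x)) (sym (cong (6 *_) z)))
      where
      z : at x ≡ 0
      z = two _ (trans (cong degree (proj₂ (vert-surj x))) e)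
    around : ∀ x → ∑ (λ d → 𝟙 (x ≟F vert d) * at x) ≡ 6 * at x
    around x = begin
      ∑ (λ d → 𝟙 (x ≟F vert d) * at x)    ≡⟨ ∑-cong
          (λ d → trans (cong (_* at x) (𝟙-⇔ (x ≟F vert d) (vert d ≟F x) sym sym))
              (*-comm (𝟙 (vert d ≟F x)) (at x))) ⟩
      ∑ (λ d → at x * 𝟙 (vert d ≟F x))    ≡⟨ ∑-* (at x) (λ d → 𝟙 (vert d ≟F x)) ⟩
      at x * ∑ (λ d → 𝟙 (vert d ≟F x))    ≡⟨ cong (at x *_) (degree-∑ x) ⟨
      at x * degree x                     ≡⟨ *-comm (at x) _ ⟩
      degree x * at x                     ≡⟨ six x ⟩
      6 * at x                            ∎

  -- A union of components of the colour class.
  record Region (P : Fin F → Bool) : Set where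
    field
      coloured : ∀ d → P (proj₁ d) ≡ true → B d
      closed   : Closed (λ t → P t ≡ true)

  module _ (P : Fin F → Bool) where
    π ν φ : Dart F → ℕ
    π d = bool→ℕ (P (proj₁ d))
    ν d = bool→ℕ (not (P (proj₁ d)))
    φ d = π d * ν (glue d)

    area perimeter : ℕ
    area      = sumFin F (bool→ℕ ∘ P)
    perimeter = ∑ φ

  module _ {P : Fin F → Bool} (region : Region P) where
    open Region region

    ∑π≡3area : ∑ (π P) ≡ 3 * area P
    ∑π≡3area = trans (sumFin-cong F (λ t → solve-triple (bool→ℕ (P t)))) (sumFin-* F 3 (bool→ℕ ∘ P))
      where
      solve-triple : ∀ a → a + (a + (a + 0)) ≡ 3 * a
      solve-triple = solve-∀

    -- Four consecutive corners of the region force, by the colour rule, all corners at the vertex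
    -- into it. So this marks the corners at interior vertices.
    inner : Dart F → ℕ
    inner d = π P d * (π P (R d) * (π P (R (R d)) * π P (iter 3 R d)))

    inner-cases : ∀ d → (P (proj₁ d) ≡ true × P (proj₁ (R d)) ≡ true × P (proj₁ (R (R d))) ≡ true ×
        P (proj₁ (iter 3 R d)) ≡ true
                          × inner d ≡ 1) ⊎ inner d ≡ 0
    inner-cases d with P (proj₁ d) | P (proj₁ (R d)) | P (proj₁ (R (R d))) | P (proj₁ (iter 3 R d))
    ... | false | _     | _     | _     = inj₂ refl
    ... | true  | false | _     | _     = inj₂ refl
    ... | true  | true  | false | _     = inj₂ refl
    ... | true  | true  | true  | false = inj₂ refl
    ... | true  | true  | true  | true  = inj₁ (refl , refl , refl , refl , refl)

    fourth : ∀ d → P (proj₁ d) ≡ true → P (proj₁ (R d)) ≡ true → P (proj₁ (R (R d))) ≡ true →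
      P (proj₁ (iter 3 R d)) ≡ true → P (proj₁ (iter 4 R d)) ≡ true
    fourth d p₀ p₁ p₂ p₃ = closed (iter 3 R d) (trans (sym (proj₁ (opposite d
      (trans (coloured d p₀) (sym (coloured (R d) p₁))) (trans (coloured d p₀) (sym (coloured (R (R d)) p₂))))))
      (coloured (iter 3 R d) p₃)) p₃

    inner-step : ∀ d → inner d ≡ 1 → inner (R d) ≡ 1
    inner-step d e with inner-cases d
    ... | inj₂ z = ⊥-elim (0≢1+n (trans (sym z) e))
    ... | inj₁ (p₀ , p₁ , p₂ , p₃ , _) rewrite fourth d p₀ p₁ p₂ p₃ | p₁ | p₂ | p₃ = refl

    inner-iter : ∀ k d → inner d ≡ 1 → inner (iter k R d) ≡ 1
    inner-iter zero    d e = e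
    inner-iter (suc k) d e = inner-step _ (inner-iter k d e)

    inner-R : ∀ d → inner (R d) ≡ inner d
    inner-R d with inner-cases (R d)
    ... | inj₁ (_ , _ , _ , _ , e) = trans e (sym (trans (cong inner (sym (R⁶ d)))
            (subst (λ x → inner x ≡ 1) (iter-comm R 5 d) (inner-iter 5 (R d) e))))
    ... | inj₂ z with inner-cases d
    ...   | inj₂ z′ = trans z (sym z′)
    ...   | inj₁ (_ , _ , _ , _ , e) = ⊥-elim (0≢1+n (trans (sym z) (inner-step d e)))

    inner-degree2 : ∀ d → degree (vert d) ≡ 2 → inner d ≡ 0
    inner-degree2 d two with inner-cases d
    ... | inj₂ z = z
    ... | inj₁ (p₀ , p₁ , _) = ⊥-elim (proj₂ (degree2 d two) (trans (coloured d p₀) (sym (coloured (R d) p₁))))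

    bool-split : ∀ a b → bool→ℕ a ≡ bool→ℕ a * bool→ℕ (not b) + bool→ℕ a * bool→ℕ b
    bool-split true  true  = refl
    bool-split true  false = refl
    bool-split false _     = refl

    -- Around a boundary vertex the corners of the region form clockwise runs of length 1, 2 or 3;
    -- corner₀, corner₁, corner₂ mark the beginnings of the runs of length at least 1, 2, 3.
    corner₀ corner₁ corner₂ : Dart F → ℕ
    corner₀ d = π P d * ν P (R⁻ d)
    corner₁ d = corner₀ d * π P (R d)
    corner₂ d = corner₀ d * (π P (R d) * π P (R (R d)))

    -- Sort the corners of the region by the number of region corners just before them: none, one,
    -- two, at least three. Then rotate each class back to the first of the corners it looks at.
    ∑-corners : ∑ (π P) ≡ ∑ corner₀ + (∑ corner₁ + (∑ corner₂ + ∑ inner))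
    ∑-corners = begin
      ∑ (π P)                                    ≡⟨ ∑-cong split ⟩
      ∑ (λ d → corner₀ d + (c₁ d + (c₂ d + c₃ d))) ≡⟨ ∑-+₄ corner₀ c₁ c₂ c₃ ⟩
      ∑ corner₀ + (∑ c₁ + (∑ c₂ + ∑ c₃))         ≡⟨ cong (∑ corner₀ +_) (cong₂ _+_ (shift c₁ corner₁ shift₁)
          (cong₂ _+_ (trans (sym (∑-R c₂)) (shift (c₂ ∘ R) corner₂ shift₂))
            (trans (sym (∑-R c₃)) (trans (sym (∑-R (c₃ ∘ R))) (shift (c₃ ∘ R ∘ R) inner shift₃))))) ⟩
      ∑ corner₀ + (∑ corner₁ + (∑ corner₂ + ∑ inner)) ∎
      where
      open ≡-Reasoning
      c₁ c₂ c₃ : Dart F → ℕ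
      c₁ d = π P d * (π P (R⁻ d) * ν P (R⁻ (R⁻ d)))
      c₂ d = π P d * (π P (R⁻ d) * (π P (R⁻ (R⁻ d)) * ν P (R⁻ (R⁻ (R⁻ d)))))
      c₃ d = π P d * (π P (R⁻ d) * (π P (R⁻ (R⁻ d)) * π P (R⁻ (R⁻ (R⁻ d)))))
      split : ∀ d → π P d ≡ corner₀ d + (c₁ d + (c₂ d + c₃ d))
      split d with P (proj₁ d) | P (proj₁ (R⁻ d)) | P (proj₁ (R⁻ (R⁻ d))) | P (proj₁ (R⁻ (R⁻ (R⁻ d))))
      ... | false | _     | _     | _     = refl
      ... | true  | false | _     | _     = refl
      ... | true  | true  | false | _     = refl
      ... | true  | true  | true  | false = refl
      ... | true  | true  | true  | true  = refl
      shift : ∀ f h → (∀ d → f (R d) ≡ h d) → ∑ f ≡ ∑ h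
      shift f h e = trans (sym (∑-R f)) (∑-cong e)
      perm₁ : ∀ a b z → a * (b * z) ≡ b * z * a
      perm₁ = solve-∀
      perm₂ : ∀ a b z y → a * (b * (z * y)) ≡ z * y * (b * a)
      perm₂ = solve-∀
      perm₃ : ∀ a b z y → a * (b * (z * y)) ≡ y * (z * (b * a))
      perm₃ = solve-∀
      shift₁ : ∀ d → c₁ (R d) ≡ corner₁ d
      shift₁ d rewrite R⁻R d = perm₁ (π P (R d)) (π P d) _
      shift₂ : ∀ d → c₂ (R (R d)) ≡ corner₂ d
      shift₂ d rewrite R⁻R (R d) | R⁻R d = perm₂ (π P (R (R d))) (π P (R d)) (π P d) _
      shift₃ : ∀ d → c₃ (R (R (R d))) ≡ inner d
      shift₃ d rewrite R⁻R (R (R d)) | R⁻R (R d) | R⁻R d = perm₃ (π P (iter 3 R d)) (π P (R (R d)))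
          (π P (R d)) (π P d)

    -- Interior plus exterior angle is 180 degrees: the run of corners that begins at the head of a
    -- boundary dart has length 1, 2, 3 when the turn is 2, 1, 0.
    turn-corners : ∀ x → φ P x * τ x +
        (φ P x + (φ P x * π P (R (next x)) + φ P x * (π P (R (next x)) * π P (R (R (next x)))))) ≡ 3 * φ P x
    turn-corners x with P (proj₁ x) in eq
    ... | false = refl
    ... | true with P (proj₁ (glue x))
    ...   | true = refl
    ...   | false with turnAt x | P (proj₁ (R (next x))) in eq₁ | P (proj₁ (R (R (next x)))) in eq₂
    ...     | _ , _ , sharp _    | false | _     = refl
    ...     | _ , _ , sharp ¬p   | true  | _     = ⊥-elim (¬p (coloured (R (next x)) eq₁))
    ...     | _ , _ , blunt p _  | false | _     with () ← trans (sym eq₁) (closed (next x) p eq)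
    ...     | _ , _ , blunt _ _  | true  | false = refl
    ...     | _ , _ , blunt _ ¬q | true  | true  = ⊥-elim (¬q (coloured (R (R (next x))) eq₂))
    ...     | _ , _ , flat p _   | false | _     with () ← trans (sym eq₁) (closed (next x) p eq)
    ...     | _ , _ , flat _ q   | true  | false with () ← trans (sym eq₂) (closed (R (next x)) q eq₁)
    ...     | _ , _ , flat _ _   | true  | true  = refl

    ∑-turn-corners : ∑ (λ x → φ P x * τ x) + (∑ corner₀ + (∑ corner₁ + ∑ corner₂)) ≡ 3 * perimeter P
    ∑-turn-corners = begin
      ∑ (λ x → φ P x * τ x) + (∑ corner₀ + (∑ corner₁ + ∑ corner₂))
        ≡⟨ cong (∑ (λ x → φ P x * τ x) +_) (cong₂ _+_ (back corner₀ k₀ (λ x → φ-next x))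
             (cong₂ _+_ (back corner₁ k₁ (λ x → cong (_* π P (R (next x))) (φ-next x)))
                        (back corner₂ k₂ (λ x → cong (_* (π P (R (next x)) * π P (R (R (next x)))))
                            (φ-next x))))) ⟩
      ∑ (λ x → φ P x * τ x) + (∑ k₀ + (∑ k₁ + ∑ k₂))
        ≡⟨ ∑-+₄ (λ x → φ P x * τ x) k₀ k₁ k₂ ⟨
      ∑ (λ x → φ P x * τ x + (k₀ x + (k₁ x + k₂ x)))
        ≡⟨ ∑-cong turn-corners ⟩
      ∑ (λ x → 3 * φ P x)
        ≡⟨ ∑-* 3 (φ P) ⟩
      3 * perimeter P ∎
      where
      open ≡-Reasoning
      k₀ k₁ k₂ : Dart F → ℕ
      k₀ = φ P
      k₁ x = φ P x * π P (R (next x))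
      k₂ x = φ P x * (π P (R (next x)) * π P (R (R (next x))))
      back : ∀ f h → (∀ x → f (next x) ≡ h x) → ∑ f ≡ ∑ h
      back f h e = trans (sym (∑-next f)) (∑-cong e)
      φ-next : ∀ x → corner₀ (next x) ≡ φ P x
      φ-next x = cong (λ y → π P x * ν P (glue y)) (next³ x)

    -- Gauss-Bonnet for the flat surface formed by the region: its total turning is 6 (V - E + F),
    -- where V and E count the vertices and edges in the interior of the region.
    totalTurning : ∃₂ λ a b → ∑ (λ x → φ P x * τ x) + 6 * a ≡ 6 * b
    totalTurning with ∑-rot-invariant inner inner-R inner-degree2 |
                      ∑-glue-even (λ d → π P d * π P (glue d))
                          (λ d → trans (cong (λ e → π P (glue d) * π P e) (glue-invol d))
                              (*-comm (π P (glue d)) _))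
    ... | v , inner≡ | m , inside≡ = m , area P + v , +-cancelʳ-≡ (3 * area P) _ _ (begin
      -- Three counts are combined: corners give 3 area = k₀ + k₁ + k₂ + 6 v, angles give t + k₀ +
      -- k₁ + k₂ = 3 perimeter, sides give 3 area = perimeter + 2 m.
      t + 6 * m + 3 * area P                            ≡⟨ cong (t + 6 * m +_)
          (trans (sym ∑π≡3area) ∑-corners) ⟩
      t + 6 * m + (k₀ + (k₁ + (k₂ + ∑ inner)))          ≡⟨ cong (λ z → t + 6 * m + (k₀ + (k₁ + (k₂ + z))))
          inner≡ ⟩
      t + 6 * m + (k₀ + (k₁ + (k₂ + 6 * v)))            ≡⟨ lemma₁ t m k₀ k₁ k₂ v ⟩
      t + (k₀ + (k₁ + k₂)) + (6 * m + 6 * v)            ≡⟨ cong (_+ (6 * m + 6 * v)) ∑-turn-corners ⟩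
      3 * perimeter P + (6 * m + 6 * v)                 ≡⟨ lemma₂ (perimeter P) m v ⟩
      3 * (perimeter P + 2 * m) + 6 * v                 ≡⟨ cong (λ z → 3 * z + 6 * v) edges-of-area ⟨
      3 * (3 * area P) + 6 * v                          ≡⟨ lemma₃ (area P) v ⟩
      6 * (area P + v) + 3 * area P                     ∎)
      where
      open ≡-Reasoning
      t k₀ k₁ k₂ : ℕ
      t  = ∑ (λ x → φ P x * τ x)
      k₀ = ∑ corner₀
      k₁ = ∑ corner₁
      k₂ = ∑ corner₂
      edges-of-area : 3 * area P ≡ perimeter P + 2 * m
      edges-of-area = begin
        3 * area P                                        ≡⟨ ∑π≡3area ⟨
        ∑ (π P)                                           ≡⟨ ∑-cong
            (λ d → bool-split (P (proj₁ d)) (P (proj₁ (glue d)))) ⟩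
        ∑ (λ d → φ P d + π P d * π P (glue d))            ≡⟨ ∑-+ (φ P) (λ d → π P d * π P (glue d)) ⟩
        perimeter P + ∑ (λ d → π P d * π P (glue d))      ≡⟨ cong (perimeter P +_) inside≡ ⟩
        perimeter P + 2 * m                               ∎
      lemma₁ : ∀ t m a b d v → t + 6 * m + (a + (b + (d + 6 * v))) ≡ t + (a + (b + d)) + (6 * m + 6 * v)
      lemma₁ = solve-∀
      lemma₂ : ∀ p m v → 3 * p + (6 * m + 6 * v) ≡ 3 * (p + 2 * m) + 6 * v
      lemma₂ = solve-∀
      lemma₃ : ∀ n v → 3 * (3 * n) + 6 * v ≡ 6 * (n + v) + 3 * n
      lemma₃ = solve-∀

-- Partial sums and members of lists

sumTo-snoc : ∀ k (f : ℕ → ℕ) → sumFin (suc k) (f ∘ toℕ) ≡ sumFin k (f ∘ toℕ) + f k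
sumTo-snoc zero    f = +-identityʳ (f 0)
sumTo-snoc (suc k) f = trans (cong (f 0 +_) (sumTo-snoc k (f ∘ suc))) (sym (+-assoc (f 0) _ _))

sumTo-mono : ∀ {j k} (f : ℕ → ℕ) → j ≤ k → sumFin j (f ∘ toℕ) ≤ sumFin k (f ∘ toℕ)
sumTo-mono f z≤n     = z≤n
sumTo-mono f (s≤s p) = +-monoʳ-≤ (f 0) (sumTo-mono (f ∘ suc) p)

sumFin>0 : ∀ n (P : Fin n → Bool) → 0 < sumFin n (bool→ℕ ∘ P) → ∃ λ i → P i ≡ true
sumFin>0 (suc n) P lt with P zero in eq
... | true  = zero , eq
... | false with sumFin>0 n (P ∘ suc) lt
...   | i , e = suc i , e

sumFin-≥ : ∀ n (f : Fin n → ℕ) i → f i ≤ sumFin n f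
sumFin-≥ (suc n) f zero    = m≤m+n _ _
sumFin-≥ (suc n) f (suc i) = ≤-trans (sumFin-≥ n (f ∘ suc) i) (m≤n+m _ (f zero))

positiveMultiple : ∀ {t a b} → t + 6 * a ≡ 6 * b → 0 < t → 6 ≤ t
positiveMultiple {t} {a} {b} e 0<t = +-cancelʳ-≤ (6 * a) 6 t (begin
  6 + 6 * a    ≡⟨ *-suc 6 a ⟨
  6 * suc a    ≤⟨ *-monoʳ-≤ 6 (*-cancelˡ-< 6 a b (begin-strict
    6 * a        <⟨ +-monoˡ-≤ (6 * a) 0<t ⟩
    t + 6 * a    ≡⟨ e ⟩
    6 * b        ∎)) ⟩
  6 * b        ≡⟨ e ⟨
  t + 6 * a    ∎)
  where open ≤-Reasoning

module Members {F : ℕ} where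
  open import Data.List.Membership.DecPropositional (_≟F_ {F}) using (_∈?_) public

  ∈?-length : ∀ (ts : List (Fin F)) → sumFin F (λ t → 𝟙 (t ∈? ts)) ≤ length ts
  ∈?-length []       = ≤-reflexive (sumFin-zero F)
  ∈?-length (x ∷ ts) = begin
    sumFin F (λ t → 𝟙 (t ∈? (x ∷ ts)))                              ≤⟨ sumFin-mono F head-or-tail ⟩
    sumFin F (λ t → 𝟙 (t ≟F x) * 1 + 𝟙 (t ∈? ts))                   ≡⟨ sumFin-+ F (λ t → 𝟙 (t ≟F x) * 1)
        (λ t → 𝟙 (t ∈? ts)) ⟩
    sumFin F (λ t → 𝟙 (t ≟F x) * 1) + sumFin F (λ t → 𝟙 (t ∈? ts))  ≤⟨ +-mono-≤
        (≤-reflexive (sumFin-δ F x (λ _ → 1))) (∈?-length ts) ⟩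
    suc (length ts)                                                 ∎
    where
    open ≤-Reasoning
    ∨-≤-+ : ∀ a b → bool→ℕ (a ∨ b) ≤ bool→ℕ a * 1 + bool→ℕ b
    ∨-≤-+ true  b = s≤s z≤n
    ∨-≤-+ false b = ≤-refl
    head-or-tail : ∀ t → 𝟙 (t ∈? (x ∷ ts)) ≤ 𝟙 (t ≟F x) * 1 + 𝟙 (t ∈? ts)
    head-or-tail t = ∨-≤-+ (does (t ≟F x)) (does (t ∈? ts))

  ∈?-sound : ∀ {t} (ts : List (Fin F)) → does (t ∈? ts) ≡ true → t ∈ ts
  ∈?-sound {t} ts e with t ∈? ts
  ... | yes p = p

-- Components as embedded hexagons

module Components (T : Triangulation) (col : Fin (Triangulation.F T) → Bool) (good : IsGood T col)
  (deg : ∀ x → Triangulation.degree T x ≡ 2 ⊎ Triangulation.degree T x ≡ 6) (c : Bool) where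
  open Triangulation T
  open Darts F
  open Members {F}
  open Local T col good deg
  open Moves T col good deg
  open Rows T col good deg c
  open GaussBonnet T col good deg c

  turn-Closed : ∀ {P : Fin F → Set} → Closed P → ∀ {x s y} → TurnAt x s y → P (proj₁ x) → P (proj₁ y)
  turn-Closed cl (sharp _)           p = p
  turn-Closed cl (blunt b _)         p = cl _ b p
  turn-Closed cl (flat b b′)   p = cl _ b′ (cl _ b p)

  walk-Closed : ∀ {P : Fin F → Set} → Closed P → ∀ {x k s y} → Walk x k s y → P (proj₁ x) → P (proj₁ y)
  walk-Closed cl stop    p = p
  walk-Closed {P} cl (t ∷ w) p = walk-Closed {P} cl w (turn-Closed {P} cl t p)

  walk-Fold : ∀ {x k s y} → Fold x → Walk x k s y → Fold y
  walk-Fold f stop    = f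
  walk-Fold f (t ∷ w) = walk-Fold (turn-Fold f t) w

  walk-turning : ∀ {x k s y} → Walk x k s y → sumFin k (λ i → τ (iter (toℕ i) β x)) ≡ s
  walk-turning stop = refl
  walk-turning {x} {suc k} (t ∷ w) = cong₂ _+_ (proj₁ (turn-β t)) (trans (sumFin-cong k (λ i →
    cong τ (trans (sym (iter-comm β (toℕ i) x)) (cong (iter (toℕ i) β) (proj₂ (turn-β t)))))) (walk-turning w))

  iter-Fold : ∀ {x} → Fold x → ∀ i → Fold (iter i β x)
  iter-Fold f zero    = f
  iter-Fold f (suc i) = turn-Fold (iter-Fold f i) (proj₂ (proj₂ (turnAt _)))

  iter-Closed : ∀ {P : Fin F → Set} → Closed P → ∀ {x} → P (proj₁ x) → ∀ i → P (proj₁ (iter i β x))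
  iter-Closed cl p zero    = p
  iter-Closed {P} cl p (suc i) = turn-Closed {P} cl (proj₂ (proj₂ (turnAt _))) (iter-Closed {P} cl p i)

  record Run (x : Dart F) : Set where
    field
      {k r} : ℕ
      {rf}  : Dart F
      ups   : ∀ i → i ≤ k → B (iter i X x)
      mids  : ∀ i → i < k → B (R (next (iter i X x)))
      right : RightEnd (iter k X x) r rf

    walk : ∀ i → i ≤ k → Walk x i 0 (iter i X x)
    walk zero    _ = stop
    walk (suc i) i≤ = subst (λ m → Walk x m 0 (iter (suc i) X x)) (+-comm i 1)
      (walk i (<⇒≤ i≤) ⋆ (flat (mids i i≤) (ups (suc i) i≤) ∷ stop))

  turn-right : ∀ {E r rf} → RightEnd E r rf → ∃ λ s → TurnAt E s rf × s + r ≡ 2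
  turn-right (flush ¬p)  = 2 , sharp ¬p , refl
  turn-right (over p ¬q) = 1 , blunt p ¬q , refl

  right-Fold : ∀ {E r rf} → B E → RightEnd E r rf → Fold rf
  right-Fold b (flush ¬p)  = b , ¬p
  right-Fold b (over p ¬q) = p , ¬q

  -- With the picture turned, the right end of one side is the left end of the row resting on the
  -- next side. The turn is written as a successor because the embedding argument needs it positive.
  left-of-right : ∀ {E r rf} → Fold E → RightEnd E r rf → ∃₂ λ l D′ → LeftEnd rf l E D′ ×
      TurnAt E (suc (1 ∸ l)) rf × suc (1 ∸ l) + l ≡ 2
  left-of-right {E} (b , ¬b) (flush ¬p) = 0 , _ ,
    subst (λ x → LeftEnd (next E) 0 x (U (next E))) (next³ E)
        (flush (subst (¬_ ∘ B ∘ glue) (sym (next³ E)) ¬b)) , sharp ¬p , refl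
  left-of-right {E} (b , ¬b) (over p ¬q) = 1 , _ ,
    subst (λ x → LeftEnd (R (next E)) 1 x (U′ (R (next E)))) (trans (cong (next ∘ next) e) (next³ E))
      (over (subst B (sym e) b) (subst (¬_ ∘ B ∘ glue) (sym (trans (cong (next ∘ next) e) (next³ E))) ¬b))
          , blunt p ¬q , refl
    where
    e : R⁻ (R (next E)) ≡ next E
    e = R⁻R (next E)

  module _ (noStrip : ∀ d → ¬ (∀ i → i < F * 3 → Straight c (iter i X d))) where

    run : ∀ x → B x → Run x
    run x b = go (F * 3) 0 refl (λ { zero _ → b }) (λ _ ())
      where
      go : ∀ K m → m + K ≡ F * 3 → (∀ i → i ≤ m → B (iter i X x)) →
          (∀ i → i < m → B (R (next (iter i X x)))) → Run x
      go zero m e ups mids = ⊥-elim (noStrip x (λ i i< → let i<m = subst (i <_) (trans (sym e) (+-identityʳ m)) i< in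
        ups i (<⇒≤ i<m) , mids i i<m))
      go (suc K) m e ups mids with turnAt (iter m X x)
      ... | _ , _ , sharp ¬p   = record { ups = ups ; mids = mids ; right = flush ¬p }
      ... | _ , _ , blunt p ¬q = record { ups = ups ; mids = mids ; right = over p ¬q }
      ... | _ , _ , flat p q   = go K (suc m) (trans (sym (+-suc m K)) e) ups′ mids′
        where
        ups′ : ∀ i → i ≤ suc m → B (iter i X x)
        ups′ i i≤ with m≤n⇒m<n∨m≡n i≤
        ... | inj₁ i<   = ups i (≤-pred i<)
        ... | inj₂ refl = q
        mids′ : ∀ i → i < suc m → B (R (next (iter i X x)))
        mids′ i i< with m≤n⇒m<n∨m≡n (≤-pred i<)
        ... | inj₁ i<m  = mids i i<m
        ... | inj₂ refl = p

    record Component (P : Fin F → Bool) : Set where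
      field
        part          : Fin F → Bool
        region        : Region part
        part⊆         : ∀ t → part t ≡ true → P t ≡ true
        nonempty      : 0 < area part
        isoperimetry  : 6 * area part ≤ perimeter part * perimeter part

    -- The hexagon with bottom side rf₀, ..., X^k rf₀, preceded on its boundary by E.
    module Hexagon {E rf₀ rf D′ k l r s₀ s} (foldE : Fold E) (row : Row rf₀ k l r E rf D′)
        (cap : Cap rf₀ k l r E rf)
      (bottom : ∀ i → i ≤ k → Walk rf₀ i 0 (iter i X rf₀))
      (turnE : TurnAt E (suc s₀) rf₀) (s₀+l : suc s₀ + l ≡ 2)
      (turnR : TurnAt (iter k X rf₀) s rf) (s+r : s + r ≡ 2) where
      open Row row using (left; ups; right)
      open Cap cap renaming (walk to walkUp; area to capArea)

      to-rf : Walk E (suc k + 1) (suc s₀ + 0 + (s + 0)) rf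
      to-rf = (turnE ∷ bottom k ≤-refl) ⋆ (turnR ∷ stop)

      p : ℕ
      p = suc k + suc steps

      -- The ends of the base turn by 2 - l and 2 - r and the cap by 2 + (l + r): one full turn.
      loop : Walk E p 6 E
      loop = subst₂ (λ m σ → Walk E m σ E) (+-assoc (suc k) 1 steps) total (to-rf ⋆ walkUp)
        where
        regroup : ∀ a s l r → a + 0 + (s + 0) + (2 + (l + r)) ≡ 2 + ((a + l) + (s + r))
        regroup = solve-∀
        total : suc s₀ + 0 + (s + 0) + (2 + (l + r)) ≡ 6
        total = trans (regroup (suc s₀) s l r) (cong₂ (λ a b → 2 + (a + b)) s₀+l s+r)

      onLoop : ∀ d → proj₁ d ∈ tris → proj₁ (glue d) ∈ tris ⊎ ∃ λ i → iter i β E ≡ d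
      onLoop d d∈ with edges d d∈
      ... | inj₁ g∈ = inj₁ g∈
      ... | inj₂ (inj₁ on) = let i , _ , e = on-skip to-rf on in inj₂ (i , e)
      ... | inj₂ (inj₂ (i , i≤ , refl)) = inj₂ (suc i , walk-iter (turnE ∷ bottom i i≤))

      part : Fin F → Bool
      part t = does (t ∈? tris)

      region : Region part
      region = record
        { coloured = λ d e → grown (λ t → col t ≡ c) (λ _ b _ → b) (ups 0 z≤n) (∈?-sound tris e)
        ; closed   = λ d b e → dec-true (_ ∈? tris) (stays d b (∈?-sound tris e))
        }
        where
        stays : ∀ d → B (glue d) → proj₁ d ∈ tris → proj₁ (glue d) ∈ tris
        stays d b d∈ with onLoop d d∈
        ... | inj₁ g∈         = g∈
        ... | inj₂ (i , refl) = ⊥-elim (proj₂ (iter-Fold foldE i) b)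

      P : Period β E p
      P = leastPeriod β _≟D_ E p z<s (walk-iter loop)
      open Period P using (returns; reduce; distinct) renaming (r to period; r≤bound to period≤p; r>0 to period>0)

      boundary : Dart F → Bool
      boundary d = part (proj₁ d) ∧ not (part (proj₁ (glue d)))

      φ-boundary : ∀ d → φ part d ≡ bool→ℕ (boundary d)
      φ-boundary d with part (proj₁ d) | part (proj₁ (glue d))
      ... | false | _     = refl
      ... | true  | false = refl
      ... | true  | true  = refl

      In : Fin F → Set
      In t = part t ≡ true

      rf₀∈ : In (proj₁ rf₀)
      rf₀∈ = dec-true (_ ∈? tris) (base 0 z≤n)

      E∈ : In (proj₁ E)
      E∈ = walk-Closed {In} closed walkUp
          (turn-Closed {In} closed turnR (walk-Closed {In} closed (bottom k ≤-refl) rf₀∈))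
        where open Region region

      outside : ∀ i → part (proj₁ (glue (iter i β E))) ≡ false
      outside i = dec-false (_ ∈? tris) λ g∈ → proj₂ (iter-Fold foldE i)
        (Region.coloured region (glue (iter i β E)) (dec-true (_ ∈? tris) g∈))

      boundary-sound : ∀ i → boundary (iter i β E) ≡ true
      boundary-sound i = cong₂ (λ a b → a ∧ not b) (iter-Closed {In} (Region.closed region) E∈ i) (outside i)

      boundary-complete : ∀ d → boundary d ≡ true → ∃ λ (i : Fin period) → iter (toℕ i) β E ≡ d
      boundary-complete d e with part (proj₁ d) in d∈ | part (proj₁ (glue d)) in g∉
      ... | true | false with onLoop d (∈?-sound tris d∈)
      ...   | inj₁ g∈         = case trans (sym g∉) (dec-true (_ ∈? tris) g∈) of λ ()
      ...   | inj₂ (i , refl) = reduce i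

      ∑-boundary : ∀ f → ∑ (λ d → φ part d * f d) ≡ sumFin period (λ i → f (iter (toℕ i) β E))
      ∑-boundary f = trans (∑-cong (λ d → cong (_* f d) (φ-boundary d)))
        (∑-enumerate period (λ i → iter (toℕ i) β E) distinct boundary (boundary-sound ∘ toℕ)
            boundary-complete f)

      perimeter≡period : perimeter part ≡ period
      perimeter≡period = begin
        perimeter part                  ≡⟨ ∑-cong (λ d → *-identityʳ (φ part d)) ⟨
        ∑ (λ d → φ part d * 1)          ≡⟨ ∑-boundary (λ _ → 1) ⟩
        sumFin period (λ _ → 1)         ≡⟨ sumFin-const period 1 ⟩
        period * 1                      ≡⟨ *-identityʳ period ⟩
        period                          ∎
        where open ≡-Reasoning

      turningTo : ℕ → ℕ
      turningTo j = sumFin j (λ i → τ (iter (toℕ i) β E))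

      τE>0 : 0 < τ E
      τE>0 = subst (0 <_) (sym (proj₁ (turn-β turnE))) z<s

      turning>0 : 0 < turningTo period
      turning>0 = ≤-trans (≤-trans τE>0 (m≤m+n (τ E) 0)) (sumTo-mono (λ i → τ (iter i β E)) period>0)

      6≤turning : 6 ≤ turningTo period
      6≤turning = positiveMultiple {turningTo period} {proj₁ gb} {proj₁ (proj₂ gb)}
        (trans (cong (_+ 6 * proj₁ gb) (sym (∑-boundary τ))) (proj₂ (proj₂ gb))) turning>0
        where
        gb : ∃₂ λ a b → ∑ (λ x → φ part x * τ x) + 6 * a ≡ 6 * b
        gb = totalTurning region

      -- One period already turns by 6, so the loop, which turns by 6 and whose next turn is positive,
      -- is a single period: the hexagon is embedded in the surface.
      period≡p : period ≡ p
      period≡p with m≤n⇒m<n∨m≡n period≤p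
      ... | inj₂ e  = e
      ... | inj₁ lt = ⊥-elim (<-irrefl refl (begin-strict
        6                                              ≤⟨ 6≤turning ⟩
        turningTo period                               <⟨ m<m+n _ (subst (0 <_) (cong τ (sym returns)) τE>0) ⟩
        turningTo period + τ (iter period β E)         ≡⟨ sumTo-snoc period (λ i → τ (iter i β E)) ⟨
        turningTo (suc period)                         ≤⟨ sumTo-mono (λ i → τ (iter i β E)) lt ⟩
        turningTo p                                    ≡⟨ walk-turning loop ⟩
        6                                              ∎))
        where open ≤-Reasoning

      isoperimetry : 6 * area part ≤ perimeter part * perimeter part
      isoperimetry = begin
        6 * area part                                          ≤⟨ *-monoʳ-≤ 6 (∈?-length tris) ⟩
        6 * length tris                                              ≤⟨ isoperimetric (suc k) (suc steps)
            (length tris) (+-mono-≤ (left≤1 left) (right≤1 right)) capArea ⟩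
        p * p                                                        ≡⟨ cong₂ _*_ perimeter≡p perimeter≡p ⟨
        perimeter part * perimeter part                              ∎
        where
        open ≤-Reasoning
        perimeter≡p : perimeter part ≡ p
        perimeter≡p = trans perimeter≡period period≡p

    firstFold : ∀ {P} → Region P → ∀ t → P t ≡ true → ∃ λ x → Fold x × P (proj₁ x) ≡ true
    firstFold {P} region t t∈ = rf , right-Fold (ups k ≤-refl) right ,
      turn-Closed {λ t → P t ≡ true} closed (proj₁ (proj₂ (turn-right right)))
          (walk-Closed {λ t → P t ≡ true} closed (walk k ≤-refl) t∈)
      where
      open Region region
      open Run (run (t , zero) (coloured (t , zero) t∈))

    hexagon : ∀ {P E rf₀ rf D′ k l r s₀ s} → Region P → P (proj₁ rf₀) ≡ true →
      Fold E → (row : Row rf₀ k l r E rf D′) → Cap rf₀ k l r E rf →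
      (∀ i → i ≤ k → Walk rf₀ i 0 (iter i X rf₀)) →
      TurnAt E (suc s₀) rf₀ → suc s₀ + l ≡ 2 → TurnAt (iter k X rf₀) s rf → s + r ≡ 2 → Component P
    hexagon {P} region rf₀∈P foldE row cap bottom turnE s₀+l turnR s+r = record
      { part         = part
      ; region       = H.region
      ; part⊆        = λ t e → Cap.grown cap (λ t → P t ≡ true)
            (Region.closed region) rf₀∈P (∈?-sound (Cap.tris cap) e)
      ; nonempty     = ≤-trans (≤-reflexive (cong bool→ℕ (sym rf₀∈))) (sumFin-≥ F (bool→ℕ ∘ part) _)
      ; isoperimetry = isoperimetry
      }
      where
      module H = Hexagon foldE row cap bottom turnE s₀+l turnR s+r
      open H using (part; rf₀∈; isoperimetry)

    -- The first run serves to reach a genuine corner; the second, which starts there, is the base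
    -- of the hexagon.
    component : ∀ {P} → Region P → ∀ t → P t ≡ true → Component P
    component {P} region t t∈ with firstFold region t t∈
    ... | x , foldx , x∈ with run x (proj₁ foldx)
    ...   | run₁ with left-of-right (walk-Fold foldx (Run.walk run₁ _ ≤-refl)) (Run.right run₁)
                    | run _ (proj₁ (right-Fold (Run.ups run₁ _ ≤-refl) (Run.right run₁)))
    ...     | l , D′ , left , turnE , s₀+l | run₂ = hexagon region
                (turn-Closed {λ t → P t ≡ true} closed turnE
                    (walk-Closed {λ t → P t ≡ true} closed (Run.walk run₁ _ ≤-refl) x∈))
                (walk-Fold foldx (Run.walk run₁ _ ≤-refl)) row (capOf noStrip row) (Run.walk run₂)
                turnE s₀+l (proj₁ (proj₂ (turn-right (Run.right run₂))))
                    (proj₂ (proj₂ (turn-right (Run.right run₂))))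
      where
      open Region region using (closed)
      row = record { left = left ; ups = Run.ups run₂ ; mids = Run.mids run₂ ; right = Run.right run₂ }

    module Peel {P : Fin F → Bool} (region : Region P) (comp : Component P) where
      open Component comp renaming (region to region′)
      rest : Fin F → Bool
      rest t = P t ∧ not (part t)

      rest-true : ∀ t → rest t ≡ true → P t ≡ true × part t ≡ false
      rest-true t e with P t | part t
      ... | true | false = refl , refl

      rest-region : Region rest
      rest-region = record
        { coloured = λ d e → Region.coloured region d (proj₁ (rest-true _ e))
        ; closed   = λ d b e → let p , q = rest-true _ e in
            cong₂ (λ x y → x ∧ not y) (Region.closed region d b p) (separate d (Region.coloured region d p) q)
        }
        where
        separate : ∀ d → B d → part (proj₁ d) ≡ false → part (proj₁ (glue d)) ≡ false
        separate d b q with part (proj₁ (glue d)) in g∈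
        ... | false = refl
        ... | true  = case trans (sym q) (subst (λ e → part (proj₁ e) ≡ true) (glue-invol d)
                        (Region.closed region′ (glue d) (trans (cong colour (glue-invol d)) b) g∈)) of λ ()

      area-split : area P ≡ area part + area rest
      area-split = trans (sumFin-cong F pointwise) (sumFin-+ F (bool→ℕ ∘ part) (bool→ℕ ∘ rest))
        where
        pointwise : ∀ t → bool→ℕ (P t) ≡ bool→ℕ (part t) + bool→ℕ (rest t)
        pointwise t with P t in p | part t in q
        ... | true  | true  = refl
        ... | true  | false = refl
        ... | false | false = refl
        ... | false | true  = case trans (sym p) (part⊆ t q) of λ ()

      -- Both pieces are closed under crossing into the same colour, so no side lies between them.
      perimeter-split : perimeter P ≡ perimeter part + perimeter rest
      perimeter-split = trans (∑-cong pointwise) (∑-+ (φ part) (φ rest))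
        where
        pointwise : ∀ d → φ P d ≡ φ part d + φ rest d
        pointwise d with P (proj₁ d) in p | part (proj₁ d) in q | P (proj₁ (glue d)) in p′
          | part (proj₁ (glue d)) in q′
        ... | false | false | _     | _     = refl
        ... | false | true  | _     | _     = case trans (sym p) (part⊆ _ q) of λ ()
        ... | true  | false | true  | false = refl
        ... | true  | false | false | false = refl
        ... | true  | true  | false | false = refl
        ... | true  | true  | true  | true  = refl
        ... | _     | _     | false | true  = case trans (sym p′) (part⊆ _ q′) of λ ()
        ... | true  | false | true  | true  = case trans (sym q)
            (subst (λ e → part (proj₁ e) ≡ true) (glue-invol d)
                (Region.closed region′ (glue d)
                    (trans (cong colour (glue-invol d)) (Region.coloured region d p)) q′)) of λ ()
        ... | true  | true  | true  | false = case trans (sym q′)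
            (Region.closed region′ d (Region.coloured region (glue d) p′) q) of λ ()

    -- Squares are superadditive, so the bounds for the components add up. The recursion is on the
    -- area bound `n`, which drops because a component is nonempty.
    area≤perimeter² : ∀ n {P} → area P ≤ n → Region P → 6 * area P ≤ perimeter P * perimeter P
    area≤perimeter² n {P} a≤n region with area P in eq
    ... | zero  = z≤n
    area≤perimeter² (suc n) {P} (s≤s a≤n) region | suc a
      with sumFin>0 F P (subst (0 <_) (sym eq) z<s)
    ... | t , t∈ = begin
      6 * suc a                                        ≡⟨ cong (6 *_) (trans (sym eq) area-split) ⟩
      6 * (area part + area rest)                      ≡⟨ *-distribˡ-+ 6 (area part) (area rest) ⟩
      6 * area part + 6 * area rest                    ≤⟨ +-mono-≤ isoperimetry
          (area≤perimeter² n rest≤n rest-region) ⟩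
      perimeter part * perimeter part + perimeter rest * perimeter rest
                                                       ≤⟨ m≤m+n _ (2 * (perimeter part * perimeter rest)) ⟩
      perimeter part * perimeter part + perimeter rest * perimeter rest + 2 * (perimeter part * perimeter rest)
                                                       ≡⟨ square (perimeter part) (perimeter rest) ⟩
      (perimeter part + perimeter rest) * (perimeter part + perimeter rest)
                                                       ≡⟨ cong₂ _*_ perimeter-split perimeter-split ⟨
      perimeter P * perimeter P                        ∎
      where
      open ≤-Reasoning
      comp = component region t t∈
      open Component comp using (part; nonempty; isoperimetry)
      open Peel region comp
      square : ∀ a b → a * a + b * b + 2 * (a * b) ≡ (a + b) * (a + b)
      square = solve-∀
      rest≤n : area rest ≤ n
      rest≤n = ≤-trans (≤-pred (≤-trans (+-monoˡ-≤ (area rest) nonempty)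
          (≤-reflexive (trans (sym area-split) eq)))) a≤n

-- Fold count and the two colour classes

module Colouring (T : Triangulation) (col : Fin (Triangulation.F T) → Bool) (good : IsGood T col)
  (deg : ∀ x → Triangulation.degree T x ≡ 2 ⊎ Triangulation.degree T x ≡ 6) where
  open Triangulation T
  open Darts F

  colourClass : Bool → Fin F → Bool
  colourClass c t = does (col t ≟B c)

  class-true : ∀ c t → colourClass c t ≡ true → col t ≡ c
  class-true c t e with col t ≟B c
  ... | yes p = p

  wholeClass : ∀ c → GaussBonnet.Region T col good deg c (colourClass c)
  wholeClass c = record
    { coloured = λ d e → class-true c _ e
    ; closed   = λ d b _ → dec-true (col _ ≟B c) b
    }

  changes : Dart F → ℕ
  changes d = 𝟙 (¬? (col (proj₁ d) ≟B col (proj₁ (glue d))))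

  foldCount-∑ : foldCount T col ≡ ∑ changes / 2
  foldCount-∑ = trans (proj₂ terms) (cong (_/ 2) (sumFin-cong F perTriangle))
    where
    terms : Σ (Fin F → ℕ) λ h → foldCount T col ≡ sumFin F h / 2
    terms = _ , refl
    perTriangle : ∀ t → proj₁ terms t ≡ sumFin 3 (λ i → changes (t , i))
    perTriangle t with col t ≟B col (proj₁ (glue (t , zero))) | col t ≟B col (proj₁ (glue (t , suc zero)))
                     | col t ≟B col (proj₁ (glue (t , suc (suc zero))))
    ... | yes _ | yes _ | yes _ = refl
    ... | yes _ | yes _ | no  _ = refl
    ... | yes _ | no  _ | yes _ = refl
    ... | yes _ | no  _ | no  _ = refl
    ... | no  _ | yes _ | yes _ = refl
    ... | no  _ | yes _ | no  _ = refl
    ... | no  _ | no  _ | yes _ = refl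
    ... | no  _ | no  _ | no  _ = refl

  φ′ : Bool → Dart F → ℕ
  φ′ c d = bool→ℕ (colourClass c (proj₁ d)) * bool→ℕ (not (colourClass c (proj₁ (glue d))))

  changes-split : ∀ d → changes d ≡ φ′ true d + φ′ false d
  changes-split d with col (proj₁ d) | col (proj₁ (glue d))
  ... | true  | true  = refl
  ... | true  | false = refl
  ... | false | true  = refl
  ... | false | false = refl

  φ′-glue : ∀ d → φ′ true (glue d) ≡ φ′ false d
  φ′-glue d rewrite glue-invol d with col (proj₁ d) | col (proj₁ (glue d))
  ... | true  | true  = refl
  ... | true  | false = refl
  ... | false | true  = refl
  ... | false | false = refl

  black≡white : ∑ (φ′ true) ≡ ∑ (φ′ false)
  black≡white = trans (sym (∑-reindex glue glue glue-invol glue-invol (φ′ true))) (∑-cong φ′-glue)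

  -- Each fold has one dart in a black and one in a white triangle, exchanged by `glue`, so the
  -- perimeter of either class counts every fold once.
  foldCount≡ : ∀ c → ∑ (φ′ c) ≡ foldCount T col
  foldCount≡ c = sym (begin
    foldCount T col                          ≡⟨ foldCount-∑ ⟩
    ∑ changes / 2                            ≡⟨ cong (_/ 2)
        (trans (∑-cong changes-split) (∑-+ (φ′ true) (φ′ false))) ⟩
    (∑ (φ′ true) + ∑ (φ′ false)) / 2         ≡⟨ cong (_/ 2) (cong₂ _+_ (same true c) (same false c)) ⟩
    (∑ (φ′ c) + ∑ (φ′ c)) / 2                ≡⟨ cong (_/ 2) (double (∑ (φ′ c))) ⟩
    ∑ (φ′ c) * 2 / 2                         ≡⟨ m*n/n≡m (∑ (φ′ c)) 2 ⟩
    ∑ (φ′ c)                                 ∎)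
    where
    open ≡-Reasoning
    same : ∀ a b → ∑ (φ′ a) ≡ ∑ (φ′ b)
    same true  true  = refl
    same true  false = black≡white
    same false true  = sym black≡white
    same false false = refl
    double : ∀ n → n + n ≡ n * 2
    double = solve-∀

  classes : sumFin F (bool→ℕ ∘ colourClass true) + sumFin F (bool→ℕ ∘ colourClass false) ≡ F
  classes = begin
    sumFin F (bool→ℕ ∘ colourClass true) + sumFin F (bool→ℕ ∘ colourClass false)
      ≡⟨ sumFin-+ F (bool→ℕ ∘ colourClass true) (bool→ℕ ∘ colourClass false) ⟨
    sumFin F (λ t → bool→ℕ (colourClass true t) + bool→ℕ (colourClass false t))
      ≡⟨ sumFin-cong F one ⟩
    sumFin F (λ _ → 1)  ≡⟨ sumFin-const F 1 ⟩
    F * 1               ≡⟨ *-identityʳ F ⟩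
    F                   ∎
    where
    open ≡-Reasoning
    one : ∀ t → bool→ℕ (colourClass true t) + bool→ℕ (colourClass false t) ≡ 1
    one t with col t
    ... | true  = refl
    ... | false = refl

  module _ (x : Fin V) (two : degree x ≡ 2) where
    classBound : ∀ c → 6 * sumFin F (bool→ℕ ∘ colourClass c) ≤ foldCount T col * foldCount T col
    classBound c = subst (λ f → 6 * sumFin F (bool→ℕ ∘ colourClass c) ≤ f * f) (foldCount≡ c)
      (Components.area≤perimeter² T col good deg c (Moves.noStrip T col good deg x two c) _ ≤-refl
          (wholeClass c))

    3F≤f² : 3 * F ≤ foldCount T col * foldCount T col
    3F≤f² = *-cancelˡ-≤ 2 (begin
      2 * (3 * F)                     ≡⟨ cong (λ n → 2 * (3 * n)) classes ⟨
      2 * (3 * (a + b))               ≡⟨ regroup a b ⟩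
      6 * a + 6 * b                   ≤⟨ +-mono-≤ (classBound true) (classBound false) ⟩
      f * f + f * f                   ≡⟨ cong (f * f +_) (+-identityʳ (f * f)) ⟨
      2 * (f * f)                     ∎)
      where
      open ≤-Reasoning
      a b f : ℕ
      a = sumFin F (bool→ℕ ∘ colourClass true)
      b = sumFin F (bool→ℕ ∘ colourClass false)
      f = foldCount T col
      regroup : ∀ a b → 2 * (3 * (a + b)) ≡ 6 * a + 6 * b
      regroup = solve-∀

open Triangulation

theorem1p2 : (T : Triangulation) → (col : Fin (F T) → Bool) → IsGood T col
    → (∀ (x : Fin (V T)) → degree T x ≡ 2 ⊎ degree T x ≡ 6)
    → countFin (V T) (λ x → degree T x ≟ 2) ≡ 3
    → 3 * F T ≤ foldCount T col * foldCount T col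
theorem1p2 T col good deg three =
  -- A vertex of degree 2 is what excludes infinite strips.
  let x , two = countFin>0 (V T) (λ x → degree T x ≟ 2) (subst (0 <_) (sym three) z<s)
  in Colouring.3F≤f² T col good deg x two
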